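{- Let $n\ge 4$ and $\ell=n-3$. The set of $01$ cell-forms $\omega_{(0,1,\pi)}$, where $\pi$ runs over all orderings of the set $\{t_1,\ldots,t_\ell,\infty\}$, has cardinality $(n-2)!$, and (the classes of) its elements form a basis of the $\mathbb{Q}$-vector space $H^\ell(\mathfrak{M}_{0,n},\mathbb{Q})$.
   Context: $\mathfrak{M}_{0,n}$ is the moduli space of genus $0$ curves with $n$ ordered marked points $z_1,\ldots,z_n$. Normalizing $z_1=0$, $z_{n-1}=1$, $z_n=\infty$ and setting $t_i=z_{i+1}$ for $1\le i\le \ell=n-3$, it is identified with $\{(t_1,\ldots,t_\ell): t_i\ne 0,1,\infty,\ t_i\ne t_j \text{ for } i\neq j\}$. $H^\ell(\mathfrak{M}_{0,n},\mathbb{Q})$ denotes its algebraic de Rham cohomology over $\mathbb{Q}$ in degree $\ell$. Cell-forms: given a cyclic ordering $\gamma$ of $\{0,t_1,\ldots,t_\ell,1,\infty\}$, rotate it so that $\infty$ is in last position, $\gamma=(y_1,\ldots,y_{n-1},\infty)$; the associated cell-form is $$\omega_\gamma=[y_1,\ldots,y_{n-1},\infty]=\frac{dt_1\cdots dt_\ell}{(y_2-y_1)(y_3-y_2)\cdots(y_{n-1}-y_{n-2})}.$$ A $01$ cell-form is the cell-form $\omega_{(0,1,\pi)}$ of a cyclic ordering of the form $(0,1,\pi)$, where $\pi$ is an ordering of $\{t_1,\ldots,t_\ell,\infty\}$. -}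

module Defs where

open import Level using (0ℓ; _⊔_)
open import Algebra.Bundles using (CommutativeRing; Ring; Semiring)
open import Algebra.Module.Bundles using (LeftModule)
import Algebra.Definitions.RawMonoid as RawMonoidDefs
import Algebra.Definitions.RawSemiring as RawSemiringDefs
import Algebra.Properties.Ring as RingProperties
import Algebra.Properties.AbelianGroup as AbelianGroupProperties
import Algebra.Properties.Semiring.Sum as SemiringSum
import Algebra.Solver.Ring as RingSolver
open import Algebra.Solver.Ring.AlmostCommutativeRing
  using (fromCommutativeRing; _-Raw-AlmostCommutative⟶_)
open import Data.Bool.Base using (if_then_else_)
open import Data.Empty using (⊥-elim)
open import Data.Fin.Base using (Fin; zero; suc; toℕ)
open import Data.Fin.Properties using (_≟_)
open import Data.List.Base using (List; []; _∷_; _++_; map; allFin)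
open import Data.List.Membership.Propositional using (_∈_)
open import Data.List.Membership.Propositional.Properties using (∈-map⁻; ∈-++⁻)
open import Data.List.Relation.Binary.Disjoint.Propositional using (Disjoint)
open import Data.List.Relation.Binary.Permutation.Propositional
  using (_↭_; prep; ↭-sym; ↭⇒↭ₛ) renaming (trans to ↭-trans)
open import Data.List.Relation.Binary.Permutation.Propositional.Properties
  using (shift)
import Data.List.Relation.Binary.Permutation.Setoid.Properties as PermutationSetoid
open import Data.List.Relation.Unary.All as All using ([]; _∷_)
open import Data.List.Relation.Unary.AllPairs using ([]; _∷_)
open import Data.List.Relation.Unary.Any using (here; there)
open import Data.List.Relation.Unary.Unique.Propositional using (Unique)
import Data.List.Relation.Unary.Unique.Propositional.Properties as Uniq
open import Data.Maybe.Base as Maybe using (Maybe)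
open import Data.Nat.Base using (ℕ; zero; suc; _≤_; z≤n; s≤s)
open import Data.Nat.Properties using (1+n≰n; m≤n⇒m≤1+n)
open import Data.Product.Base using (Σ; ∃; _,_; proj₁; proj₂)
open import Data.Rational.Base as ℚ using (ℚ; 0ℚ; 1ℚ)
import Data.Rational.Properties as ℚ
open import Data.Sum.Base using (inj₁; inj₂)
open import Data.Vec.Functional using (Vector)
open import Function.Base using (_∘_)
open import Relation.Binary.Bundles using (Setoid)
import Relation.Binary.Construct.On as On
open import Relation.Binary.PropositionalEquality.Core as ≡ using (_≡_; _≢_)
import Relation.Binary.PropositionalEquality.Properties as ≡
open import Relation.Nullary.Decidable.Core using (does; dec⇒maybe)
open import Relation.Nullary.Negation.Core using (¬_)

record IsBasis {r ℓr m ℓm} {R : Ring r ℓr} (M : LeftModule R m ℓm)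
               {n : ℕ} (v : Vector (LeftModule.Carrierᴹ M) n) :
               Set (r ⊔ ℓr ⊔ m ⊔ ℓm) where
  open Ring R using (0#; _≈_) renaming (Carrier to K)
  open LeftModule M using (Carrierᴹ; _≈ᴹ_; 0ᴹ; _*ₗ_; +ᴹ-rawMonoid)
  open RawMonoidDefs +ᴹ-rawMonoid using (sum)
  field
    linearlyIndependent : (c : Vector K n) →
                          sum (λ i → c i *ₗ v i) ≈ᴹ 0ᴹ → ∀ i → c i ≈ 0#
    spanning            : (x : Carrierᴹ) →
                          ∃ λ (c : Vector K n) → x ≈ᴹ sum (λ i → c i *ₗ v i)

-- Throughout ℓ = n - 3 is the number of coordinates on
-- the moduli space, and the n marked points are 0, t₁, …, t_ℓ, 1, ∞.

data AffinePoint (ℓ : ℕ) : Set where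
  𝟎 𝟏 : AffinePoint ℓ
  t   : Fin ℓ → AffinePoint ℓ

data Point (ℓ : ℕ) : Set where
  affine : AffinePoint ℓ → Point ℓ
  ∞      : Point ℓ

private variable
  ℓ k : ℕ

-- The ring of regular functions on 𝔐₀,ₙ, presented by generators and
-- relations: it is the localisation of ℚ[t₁, …, t_ℓ] inverting the
-- differences a - b of distinct affine marked points (that is, tᵢ,
-- tᵢ - 1 and tᵢ - tⱼ for i ≠ j; ±(1 - 0) is invertible already).

infixl 6 _+_
infixl 7 _*_
infix  8 -_
infix  4 _≈_

data 𝒪 (ℓ : ℕ) : Set where
  con     : ℚ → 𝒪 ℓ
  var     : Fin ℓ → 𝒪 ℓ
  _+_ _*_ : 𝒪 ℓ → 𝒪 ℓ → 𝒪 ℓ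
  -_      : 𝒪 ℓ → 𝒪 ℓ
  1/[_-_] : (a b : AffinePoint ℓ) → .(a ≢ b) → 𝒪 ℓ

coord : AffinePoint ℓ → 𝒪 ℓ
coord 𝟎     = con 0ℚ
coord 𝟏     = con 1ℚ
coord (t i) = var i

data _≈_ {ℓ : ℕ} : 𝒪 ℓ → 𝒪 ℓ → Set where
  refl  : ∀ {f} → f ≈ f
  sym   : ∀ {f g} → f ≈ g → g ≈ f
  trans : ∀ {f g h} → f ≈ g → g ≈ h → f ≈ h

  +-cong : ∀ {f f′ g g′} → f ≈ f′ → g ≈ g′ → f + g ≈ f′ + g′
  *-cong : ∀ {f f′ g g′} → f ≈ f′ → g ≈ g′ → f * g ≈ f′ * g′
  -‿cong : ∀ {f f′} → f ≈ f′ → - f ≈ - f′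

  +-assoc     : ∀ f g h → (f + g) + h ≈ f + (g + h)
  +-comm      : ∀ f g → f + g ≈ g + f
  +-identityˡ : ∀ f → con 0ℚ + f ≈ f
  -‿inverseˡ  : ∀ f → - f + f ≈ con 0ℚ
  *-assoc     : ∀ f g h → (f * g) * h ≈ f * (g * h)
  *-comm      : ∀ f g → f * g ≈ g * f
  *-identityˡ : ∀ f → con 1ℚ * f ≈ f
  distribˡ    : ∀ f g h → f * (g + h) ≈ f * g + f * h

  con-+ : ∀ p q → con (p ℚ.+ q) ≈ con p + con q
  con-* : ∀ p q → con (p ℚ.* q) ≈ con p * con q

  1/-inverseˡ : ∀ a b .(a≢b : a ≢ b) →
                1/[ a - b ] a≢b * (coord a + - coord b) ≈ con 1ℚ

𝒪-commutativeRing : ℕ → CommutativeRing 0ℓ 0ℓ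
𝒪-commutativeRing ℓ = record
  { Carrier = 𝒪 ℓ ; _≈_ = _≈_ ; _+_ = _+_ ; _*_ = _*_ ; -_ = -_
  ; 0# = con 0ℚ ; 1# = con 1ℚ
  ; isCommutativeRing = record
    { isRing = record
      { +-isAbelianGroup = record
        { isGroup = record
          { isMonoid = record
            { isSemigroup = record
              { isMagma = record
                { isEquivalence = record { refl = refl ; sym = sym ; trans = trans }
                ; ∙-cong = +-cong }
              ; assoc = +-assoc }
            ; identity = +-identityˡ , λ f → trans (+-comm _ _) (+-identityˡ f) }
          ; inverse = -‿inverseˡ , λ f → trans (+-comm _ _) (-‿inverseˡ f)
          ; ⁻¹-cong = -‿cong }
        ; comm = +-comm }
      ; *-cong = *-cong
      ; *-assoc = *-assoc
      ; *-identity = *-identityˡ , λ f → trans (*-comm _ _) (*-identityˡ f)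
      ; distrib = distribˡ , λ f g h →
          trans (*-comm _ _) (trans (distribˡ f g h)
            (+-cong (*-comm _ _) (*-comm _ _)))
      }
    ; *-comm = *-comm
    }
  }

module 𝒪-Ring {ℓ : ℕ} where
  open CommutativeRing (𝒪-commutativeRing ℓ) public
    using (ring; semiring; +-abelianGroup; zeroˡ; zeroʳ;
           +-identityʳ; *-identityʳ; +-congˡ; *-congˡ; *-congʳ; -‿inverseʳ;
           distribʳ)
  open RingProperties ring public using (-0#≈0#; -1*x≈-x)
  open AbelianGroupProperties +-abelianGroup public
    using () renaming (⁻¹-∙-comm to -‿+-comm)
  open RawSemiringDefs (Semiring.rawSemiring semiring) public using (_^_)
  open SemiringSum semiring public
    using (sum; sum-cong-≋; ∑-distrib-+; *-distribˡ-sum)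

  con-‿- : ∀ q → con {ℓ} (ℚ.- q) ≈ - con q
  con-‿- q =
    trans (sym (+-identityʳ _))
    (trans (+-congˡ (sym (-‿inverseʳ (con q))))
    (trans (sym (+-assoc _ _ _))
    (trans (+-cong (trans (sym (con-+ (ℚ.- q) q)) con-0) refl) (+-identityˡ _))))
    where
    con-0 : con (ℚ.- q ℚ.+ q) ≈ con 0ℚ
    con-0 rewrite ℚ.+-inverseˡ q = refl

  private
    con-homomorphism : ℚ.+-*-rawRing -Raw-AlmostCommutative⟶
                       fromCommutativeRing (𝒪-commutativeRing ℓ)
    con-homomorphism = record
      { ⟦_⟧ = con ; +-homo = con-+ ; *-homo = con-* ; -‿homo = con-‿-
      ; 0-homo = refl ; 1-homo = refl }

    con≟ : (p q : ℚ) → Maybe (con {ℓ} p ≈ con q)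
    con≟ p q = Maybe.map (λ { ≡.refl → refl }) (dec⇒maybe (p ℚ.≟ q))

  open RingSolver ℚ.+-*-rawRing (fromCommutativeRing (𝒪-commutativeRing ℓ))
                  con-homomorphism con≟ public
    using (solve; _:=_; _:+_; _:*_; :-_)

∂coord : Fin ℓ → AffinePoint ℓ → 𝒪 ℓ
∂coord i 𝟎     = con 0ℚ
∂coord i 𝟏     = con 0ℚ
∂coord i (t j) = con (if does (i ≟ j) then 1ℚ else 0ℚ)

∂ : Fin ℓ → 𝒪 ℓ → 𝒪 ℓ
∂ i (con q) = con 0ℚ
∂ i (var j) = ∂coord i (t j)
∂ i (f + g) = ∂ i f + ∂ i g
∂ i (f * g) = ∂ i f * g + f * ∂ i g
∂ i (- f)   = - ∂ i f
∂ i (1/[ a - b ] a≢b) =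
  - (1/[ a - b ] a≢b * 1/[ a - b ] a≢b * (∂coord i a + - ∂coord i b))

module _ {ℓ : ℕ} where
  open 𝒪-Ring {ℓ}

  ∂-cong : ∀ i {f g : 𝒪 ℓ} → f ≈ g → ∂ i f ≈ ∂ i g
  ∂-cong i refl          = refl
  ∂-cong i (sym p)       = sym (∂-cong i p)
  ∂-cong i (trans p q)   = trans (∂-cong i p) (∂-cong i q)
  ∂-cong i (+-cong p q)  = +-cong (∂-cong i p) (∂-cong i q)
  ∂-cong i (*-cong p q)  = +-cong (*-cong (∂-cong i p) q) (*-cong p (∂-cong i q))
  ∂-cong i (-‿cong p)    = -‿cong (∂-cong i p)
  ∂-cong i (+-assoc _ _ _)  = +-assoc _ _ _
  ∂-cong i (+-comm _ _)     = +-comm _ _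
  ∂-cong i (+-identityˡ _)  = +-identityˡ _
  ∂-cong i (-‿inverseˡ _)   = -‿inverseˡ _
  ∂-cong i (*-assoc f g h)  =
    solve 6 (λ f g h f′ g′ h′ →
        ((f′ :* g :+ f :* g′) :* h :+ (f :* g) :* h′)
      := (f′ :* (g :* h) :+ f :* (g′ :* h :+ g :* h′)))
      refl f g h (∂ i f) (∂ i g) (∂ i h)
  ∂-cong i (*-comm f g)     =
    trans (+-comm _ _) (+-cong (*-comm _ _) (*-comm _ _))
  ∂-cong i (*-identityˡ f)  =
    trans (+-cong (zeroˡ f) (*-identityˡ _)) (+-identityˡ _)
  ∂-cong i (distribˡ f g h) =
    solve 6 (λ f g h f′ g′ h′ →
        (f′ :* (g :+ h) :+ f :* (g′ :+ h′))
      := ((f′ :* g :+ f :* g′) :+ (f′ :* h :+ f :* h′)))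
      refl f g h (∂ i f) (∂ i g) (∂ i h)
  ∂-cong i (con-+ _ _)      = sym (+-identityˡ _)
  ∂-cong i (con-* _ _)      = sym (trans (+-cong (zeroˡ _) (zeroʳ _)) (+-identityˡ _))
  ∂-cong i (1/-inverseˡ a b a≢b) =
    trans
      (+-congˡ (*-congˡ (+-cong (∂-coord a) (-‿cong (∂-coord b)))))
    (trans
      (solve 3 (λ u x x′ →
          ((:- (u :* u :* x′)) :* x :+ u :* x′)
        := ((:- (u :* x′)) :* (u :* x) :+ u :* x′))
        refl u x x′)
      (trans (+-cong (trans (*-congˡ (1/-inverseˡ a b a≢b)) (*-identityʳ _)) refl)
             (-‿inverseˡ _)))
    where
    ∂-coord : ∀ c → ∂ i (coord c) ≈ ∂coord i c
    ∂-coord 𝟎     = refl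
    ∂-coord 𝟏     = refl
    ∂-coord (t _) = refl
    u  = 1/[ a - b ] a≢b
    x  = coord a + - coord b
    x′ = ∂coord i a + - ∂coord i b

-- The module of k-forms is free over 𝒪
-- on the dt_I = dt_{i₁} ⋯ dt_{iₖ}, for i₁ < … < iₖ.

-- A sequence i₁ < … < iₖ in Fin ℓ, encoded by keeping or skipping each
-- element of Fin ℓ in turn.
data MultiIndex : (k ℓ : ℕ) → Set where
  []   : MultiIndex 0 0
  skip : MultiIndex k ℓ → MultiIndex k (suc ℓ)
  keep : MultiIndex k ℓ → MultiIndex (suc k) (suc ℓ)

lookup : MultiIndex k ℓ → Fin k → Fin ℓ
lookup (skip I) p       = suc (lookup I p)
lookup (keep I) zero    = zero
lookup (keep I) (suc p) = suc (lookup I p)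

omit : MultiIndex (suc k) ℓ → Fin (suc k) → MultiIndex k ℓ
omit             (skip I) p       = skip (omit I p)
omit             (keep I) zero    = skip I
omit {k = suc _} (keep I) (suc p) = keep (omit I p)

multiIndex-≤ : MultiIndex k ℓ → k ≤ ℓ
multiIndex-≤ []       = z≤n
multiIndex-≤ (skip I) = m≤n⇒m≤1+n (multiIndex-≤ I)
multiIndex-≤ (keep I) = s≤s (multiIndex-≤ I)

-- ω I is the coefficient of dt_I in ω.
Ω : (ℓ k : ℕ) → Set
Ω ℓ k = MultiIndex k ℓ → 𝒪 ℓ

infix 4 _≈Ω_
_≈Ω_ : Ω ℓ k → Ω ℓ k → Set
ω ≈Ω η = ∀ I → ω I ≈ η I

Ω-setoid : (ℓ k : ℕ) → Setoid 0ℓ 0ℓ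
Ω-setoid ℓ k = record
  { Carrier = Ω ℓ k ; _≈_ = _≈Ω_
  ; isEquivalence = record
    { refl = λ _ → refl ; sym = λ p I → sym (p I)
    ; trans = λ p q I → trans (p I) (q I) } }

infixl 6 _+Ω_
infix  8 -Ω_
infixl 7 _*Ω_

0Ω : Ω ℓ k
0Ω _ = con 0ℚ

_+Ω_ : Ω ℓ k → Ω ℓ k → Ω ℓ k
(ω +Ω η) I = ω I + η I

-Ω_ : Ω ℓ k → Ω ℓ k
(-Ω ω) I = - ω I

_*Ω_ : ℚ → Ω ℓ k → Ω ℓ k
(q *Ω ω) I = con q * ω I

-- Since d (f dt_J) = Σᵢ (∂f/∂tᵢ) dtᵢ dt_J, and moving dtᵢ into the
-- p-th place (counting from 0) costs the sign (-1)^p, the coefficient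
-- of dt_I in dω is Σ_p (-1)^p ∂ω_{I∖i_p}/∂t_{i_p}.
d : Ω ℓ k → Ω ℓ (suc k)
d ω I = sum λ p → (- con 1ℚ) ^ toℕ p * ∂ (lookup I p) (ω (omit I p))
  where open 𝒪-Ring

module _ {ℓ k : ℕ} where
  open 𝒪-Ring {ℓ}

  d-cong : {ω η : Ω ℓ k} → ω ≈Ω η → d ω ≈Ω d η
  d-cong ω≈η I = sum-cong-≋ λ p →
    *-congˡ {x = (- con 1ℚ) ^ toℕ p} (∂-cong (lookup I p) (ω≈η (omit I p)))

  d-+ : (ω η : Ω ℓ k) → d (ω +Ω η) ≈Ω d ω +Ω d η
  d-+ ω η I =
    trans (sum-cong-≋ λ p → distribˡ ((- con 1ℚ) ^ toℕ p) (∂ω ω p) (∂ω η p))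
          (∑-distrib-+ (λ p → (- con 1ℚ) ^ toℕ p * ∂ω ω p)
                       (λ p → (- con 1ℚ) ^ toℕ p * ∂ω η p))
    where
    ∂ω : Ω ℓ k → Fin (suc k) → 𝒪 ℓ
    ∂ω ω p = ∂ (lookup I p) (ω (omit I p))

  d-* : (q : ℚ) (ω : Ω ℓ k) → d (q *Ω ω) ≈Ω q *Ω d ω
  d-* q ω I =
    trans (sum-cong-≋ λ p →
             trans (*-congˡ {x = (- con 1ℚ) ^ toℕ p}
                     (trans (+-cong (zeroˡ (ω (omit I p))) refl) (+-identityˡ _)))
                   (solve 3 (λ s c f → (s :* (c :* f)) := (c :* (s :* f))) refl
                      ((- con 1ℚ) ^ toℕ p) (con q) (∂ (lookup I p) (ω (omit I p)))))
          (sym (*-distribˡ-sum (con q)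
                 (λ p → (- con 1ℚ) ^ toℕ p * ∂ (lookup I p) (ω (omit I p)))))

  -Ω≈-1*Ω : (ω : Ω ℓ k) → -Ω ω ≈Ω (ℚ.- 1ℚ) *Ω ω
  -Ω≈-1*Ω ω I = sym (trans (*-congʳ (con-‿- 1ℚ)) (-1*x≈-x (ω I)))

d-- : (ω : Ω ℓ k) → d (-Ω ω) ≈Ω -Ω d ω
d-- ω I = trans (d-cong (-Ω≈-1*Ω ω) I)
         (trans (d-* (ℚ.- 1ℚ) ω I) (sym (-Ω≈-1*Ω (d ω) I)))

d-0 : d (0Ω {ℓ} {k}) ≈Ω 0Ω
d-0 I = trans (d-cong (λ J → sym (zeroˡ (con 0ℚ))) I)
       (trans (d-* 0ℚ 0Ω I) (zeroˡ _))
  where open 𝒪-Ring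

-- As 𝔐₀,ₙ is affine, its algebraic de Rham cohomology is that of the
-- complex of global algebraic differential forms.

Closed : Ω ℓ k → Set
Closed ω = d ω ≈Ω 0Ω

Exact : Ω ℓ k → Set
Exact {k = zero}  ω = ω ≈Ω 0Ω
Exact {k = suc k} ω = ∃ λ (η : Ω _ k) → ω ≈Ω d η

exact-cong : {ω η : Ω ℓ k} → ω ≈Ω η → Exact ω → Exact η
exact-cong {k = zero}  p e I   = trans (sym (p I)) (e I)
exact-cong {k = suc _} p (α , e) = α , λ I → trans (sym (p I)) (e I)

exact-0 : {ω : Ω ℓ k} → ω ≈Ω 0Ω → Exact ω
exact-0 {k = zero}  p = p
exact-0 {k = suc _} p = 0Ω , λ I → trans (p I) (sym (d-0 I))

exact-+ : {ω η : Ω ℓ k} → Exact ω → Exact η → Exact (ω +Ω η)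
exact-+ {k = zero}  p q I = trans (+-cong (p I) (q I)) (+-identityˡ _)
exact-+ {k = suc _} (α , p) (β , q) =
  α +Ω β , λ I → trans (+-cong (p I) (q I)) (sym (d-+ α β I))

exact-* : (q : ℚ) {ω : Ω ℓ k} → Exact ω → Exact (q *Ω ω)
exact-* {k = zero}  q p I = trans (*-cong refl (p I)) (𝒪-Ring.zeroʳ _)
exact-* {k = suc _} q (α , p) =
  q *Ω α , λ I → trans (*-cong refl (p I)) (sym (d-* q α I))

exact-- : {ω : Ω ℓ k} → Exact ω → Exact (-Ω ω)
exact-- {ω = ω} e =
  exact-cong (λ I → sym (-Ω≈-1*Ω ω I)) (exact-* (ℚ.- 1ℚ) e)

module _ (ℓ k : ℕ) where
  open 𝒪-Ring {ℓ}

  private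
    Z : Set
    Z = Σ (Ω ℓ k) Closed

    _∼_ : Z → Z → Set
    (ω , _) ∼ (η , _) = Exact (ω +Ω (-Ω η))

    ≈⇒∼ : (x y : Z) → proj₁ x ≈Ω proj₁ y → x ∼ y
    ≈⇒∼ _ _ p = exact-0 λ I → trans (+-cong (p I) refl) (-‿inverseʳ _)

    0Z : Z
    0Z = 0Ω , d-0

    _+Z_ : Z → Z → Z
    (ω , p) +Z (η , q) = ω +Ω η , λ I →
      trans (d-+ ω η I) (trans (+-cong (p I) (q I)) (+-identityˡ _))

    -Z_ : Z → Z
    -Z (ω , p) = -Ω ω , λ I → trans (d-- ω I) (trans (-‿cong (p I)) -0#≈0#)

    _*Z_ : ℚ → Z → Z
    q *Z (ω , p) = q *Ω ω , λ I →
      trans (d-* q ω I) (trans (*-congˡ (p I)) (zeroʳ _))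

    ∼-refl : ∀ {x} → x ∼ x
    ∼-refl {x} = ≈⇒∼ x x (λ _ → refl)

    ∼-sym : ∀ {x y} → x ∼ y → y ∼ x
    ∼-sym {x , _} {y , _} e = exact-cong
      (λ I → solve 2 (λ a b → (:- (a :+ :- b)) := (b :+ :- a)) refl (x I) (y I))
      (exact-- e)

    ∼-trans : ∀ {x y z} → x ∼ y → y ∼ z → x ∼ z
    ∼-trans {x , _} {y , _} {z , _} e f = exact-cong
      (λ I → trans (+-assoc _ _ _) (+-congˡ (trans (sym (+-assoc _ _ _))
               (trans (+-cong (-‿inverseˡ (y I)) refl) (+-identityˡ _)))))
      (exact-+ e f)

    +-∼ : ∀ {x y u v} → x ∼ y → u ∼ v → (x +Z u) ∼ (y +Z v)
    +-∼ {x , _} {y , _} {u , _} {v , _} e f = exact-cong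
      (λ I → solve 4 (λ a b c e → ((a :+ :- b) :+ (c :+ :- e)) := ((a :+ c) :+ :- (b :+ e)))
               refl (x I) (y I) (u I) (v I))
      (exact-+ e f)

    -‿∼ : ∀ {x y} → x ∼ y → (-Z x) ∼ (-Z y)
    -‿∼ {x , _} {y , _} e = exact-cong
      (λ I → sym (-‿+-comm (x I) (- y I)))
      (exact-- e)

    *-∼ : ∀ {p q x y} → p ≡ q → x ∼ y → (p *Z x) ∼ (q *Z y)
    *-∼ {p} {_} {x , _} {y , _} ≡.refl e = exact-cong
      (λ I → solve 3 (λ c a b → (c :* (a :+ :- b)) := (c :* a :+ :- (c :* b)))
               refl (con p) (x I) (y I))
      (exact-* p e)

  -- Hᵏ(𝔐₀,ₙ, ℚ), whose elements are the closed k-forms, two of them being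
  -- identified when their difference is exact.
  H : LeftModule ℚ.+-*-ring 0ℓ 0ℓ
  H = record
    { Carrierᴹ = Z ; _≈ᴹ_ = _∼_ ; _+ᴹ_ = _+Z_ ; _*ₗ_ = _*Z_ ; 0ᴹ = 0Z ; -ᴹ_ = -Z_
    ; isLeftModule = record
      { isLeftSemimodule = record
        { +ᴹ-isCommutativeMonoid = record
          { isMonoid = record
            { isSemigroup = record
              { isMagma = record
                { isEquivalence = record
                  { refl  = λ {x} → ∼-refl {x}
                  ; sym   = λ {x} {y} → ∼-sym {x} {y}
                  ; trans = λ {x} {y} {z} → ∼-trans {x} {y} {z} }
                ; ∙-cong = λ {x} {y} {u} {v} → +-∼ {x} {y} {u} {v} }
              ; assoc = λ x y z → ≈⇒∼ ((x +Z y) +Z z) (x +Z (y +Z z))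
                                      (λ I → +-assoc _ _ _) }
            ; identity = (λ x → ≈⇒∼ (0Z +Z x) x (λ I → +-identityˡ _))
                       , (λ x → ≈⇒∼ (x +Z 0Z) x (λ I → +-identityʳ _)) }
          ; comm = λ x y → ≈⇒∼ (x +Z y) (y +Z x) (λ I → +-comm _ _) }
        ; isPreleftSemimodule = record
          { *ₗ-cong      = λ {p} {q} {x} {y} → *-∼ {p} {q} {x} {y}
          ; *ₗ-zeroˡ     = λ x → ≈⇒∼ (0ℚ *Z x) 0Z (λ I → zeroˡ _)
          ; *ₗ-distribʳ  = λ x p q → ≈⇒∼ ((p ℚ.+ q) *Z x) ((p *Z x) +Z (q *Z x))
                             (λ I → trans (*-congʳ (con-+ p q)) (distribʳ _ _ _))
          ; *ₗ-identityˡ = λ x → ≈⇒∼ (1ℚ *Z x) x (λ I → *-identityˡ _)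
          ; *ₗ-assoc     = λ p q x → ≈⇒∼ ((p ℚ.* q) *Z x) (p *Z (q *Z x))
                             (λ I → trans (*-congʳ (con-* p q)) (*-assoc _ _ _))
          ; *ₗ-zeroʳ     = λ p → ≈⇒∼ (p *Z 0Z) 0Z (λ I → zeroʳ _)
          ; *ₗ-distribˡ  = λ p x y → ≈⇒∼ (p *Z (x +Z y)) ((p *Z x) +Z (p *Z y))
                             (λ I → distribˡ _ _ _)
          } }
      ; -ᴹ‿cong = λ {x} {y} → -‿∼ {x} {y}
      ; -ᴹ‿inverse = (λ x → ≈⇒∼ ((-Z x) +Z x) 0Z (λ I → -‿inverseˡ _))
                   , (λ x → ≈⇒∼ (x +Z (-Z x)) 0Z (λ I → -‿inverseʳ _))
      }
    }

-- Forms of top degree ℓ are closed, there being no (ℓ+1)-forms.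
[_] : Ω ℓ ℓ → LeftModule.Carrierᴹ (H ℓ ℓ)
[ ω ] = ω , λ I → ⊥-elim (1+n≰n (multiIndex-≤ I))

-- Here S lists a finite set without repetition; its orderings are then
-- the permutations of the list.
Ordering : ∀ {a} {A : Set a} → List A → Set a
Ordering S = ∃ λ xs → xs ↭ S

ts : (ℓ : ℕ) → List (Point ℓ)
ts ℓ = map (affine ∘ t) (allFin ℓ)

points : (ℓ : ℕ) → List (Point ℓ)
points ℓ = affine 𝟎 ∷ ts ℓ ++ affine 𝟏 ∷ ∞ ∷ []

-- A cyclic ordering of the marked points is represented by any of the
-- orderings that it becomes when cut open.  The choice is irrelevant for
-- the cell-form, which depends only on the rotation putting ∞ last.
CyclicOrdering : ℕ → Set
CyclicOrdering ℓ = Ordering (points ℓ)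

affines before∞ after∞ : List (Point ℓ) → List (AffinePoint ℓ)

affines []              = []
affines (affine y ∷ xs) = y ∷ affines xs
affines (∞ ∷ xs)        = affines xs

before∞ []              = []
before∞ (affine y ∷ xs) = y ∷ before∞ xs
before∞ (∞ ∷ xs)        = []

after∞ []              = []
after∞ (affine y ∷ xs) = after∞ xs
after∞ (∞ ∷ xs)        = affines xs

-- y₁, …, yₙ₋₁, where (y₁, …, yₙ₋₁, ∞) is the rotation with ∞ last.
cut∞ : List (Point ℓ) → List (AffinePoint ℓ)
cut∞ xs = after∞ xs ++ before∞ xs

module _ {ℓ : ℕ} where
  private
    ∈-affines : ∀ {v} xs → v ∈ affines {ℓ} xs → affine v ∈ xs
    ∈-affines (affine y ∷ xs) (here ≡.refl) = here ≡.refl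
    ∈-affines (affine y ∷ xs) (there v∈)    = there (∈-affines xs v∈)
    ∈-affines (∞ ∷ xs)        v∈            = there (∈-affines xs v∈)

    ∈-before∞ : ∀ {v} xs → v ∈ before∞ {ℓ} xs → affine v ∈ xs
    ∈-before∞ (affine y ∷ xs) (here ≡.refl) = here ≡.refl
    ∈-before∞ (affine y ∷ xs) (there v∈)    = there (∈-before∞ xs v∈)

    ∈-after∞ : ∀ {v} xs → v ∈ after∞ {ℓ} xs → affine v ∈ xs
    ∈-after∞ (affine y ∷ xs) v∈ = there (∈-after∞ xs v∈)
    ∈-after∞ (∞ ∷ xs)        v∈ = there (∈-affines xs v∈)

    affines-unique : ∀ {xs} → Unique xs → Unique (affines {ℓ} xs)
    affines-unique {[]}            []       = []
    affines-unique {affine y ∷ xs} (y∉ ∷ u) =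
      All.tabulate (λ { v∈ ≡.refl → All.lookup y∉ (∈-affines xs v∈) ≡.refl })
      ∷ affines-unique u
    affines-unique {∞ ∷ xs}        (_ ∷ u)  = affines-unique u

    before∞-unique : ∀ {xs} → Unique xs → Unique (before∞ {ℓ} xs)
    before∞-unique {[]}            []       = []
    before∞-unique {affine y ∷ xs} (y∉ ∷ u) =
      All.tabulate (λ { v∈ ≡.refl → All.lookup y∉ (∈-before∞ xs v∈) ≡.refl })
      ∷ before∞-unique u
    before∞-unique {∞ ∷ xs}        (_ ∷ u)  = []

    after∞-unique : ∀ {xs} → Unique xs → Unique (after∞ {ℓ} xs)
    after∞-unique {[]}            []      = []
    after∞-unique {affine y ∷ xs} (_ ∷ u) = after∞-unique u
    after∞-unique {∞ ∷ xs}        (_ ∷ u) = affines-unique u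

    disjoint : ∀ {xs} → Unique xs → Disjoint (after∞ {ℓ} xs) (before∞ xs)
    disjoint {affine y ∷ xs} (y∉ ∷ u) (v∈a , here ≡.refl) =
      All.lookup y∉ (∈-after∞ xs v∈a) ≡.refl
    disjoint {affine y ∷ xs} (y∉ ∷ u) (v∈a , there v∈b) = disjoint u (v∈a , v∈b)

    affine-injective : ∀ {x y : AffinePoint ℓ} → affine x ≡ affine y → x ≡ y
    affine-injective ≡.refl = ≡.refl

    t-injective : ∀ {i j : Fin ℓ} → t i ≡ t j → i ≡ j
    t-injective ≡.refl = ≡.refl

    points-unique : Unique (points ℓ)
    points-unique =
      All.tabulate (λ { x∈ ≡.refl → 𝟎∉ x∈ })
      ∷ Uniq.++⁺ (Uniq.map⁺ (t-injective ∘ affine-injective) (Uniq.allFin⁺ ℓ))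
                 (((λ ()) ∷ []) ∷ [] ∷ [])
                 (λ { (v∈ , here ≡.refl)         → ts∌𝟏 v∈
                    ; (v∈ , there (here ≡.refl)) → ts∌∞ v∈ })
      where
      ts∌𝟏 : ¬ affine 𝟏 ∈ ts ℓ
      ts∌𝟏 p with ∈-map⁻ (affine ∘ t) p
      ... | _ , _ , ()
      ts∌∞ : ¬ ∞ ∈ ts ℓ
      ts∌∞ p with ∈-map⁻ (affine ∘ t) p
      ... | _ , _ , ()
      𝟎∉ : ¬ affine 𝟎 ∈ ts ℓ ++ affine 𝟏 ∷ ∞ ∷ []
      𝟎∉ p with ∈-++⁻ (ts ℓ) p
      ... | inj₂ (there (there ()))
      ... | inj₁ q with ∈-map⁻ (affine ∘ t) q
      ...   | _ , _ , ()

  cut∞-unique : (γ : CyclicOrdering ℓ) → Unique (cut∞ (proj₁ γ))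
  cut∞-unique (xs , xs↭) =
    Uniq.++⁺ (after∞-unique u) (before∞-unique u) (disjoint u)
    where
    u : Unique xs
    u = PermutationSetoid.Unique-resp-↭ (≡.setoid (Point ℓ))
          (↭⇒↭ₛ (↭-sym xs↭)) points-unique

-- 1 / ((y₂ - y₁) (y₃ - y₂) ⋯)
cellFunction : (ys : List (AffinePoint ℓ)) → Unique ys → 𝒪 ℓ
cellFunction []            _                = con 1ℚ
cellFunction (_ ∷ [])      _                = con 1ℚ
cellFunction (x ∷ y ∷ ys) ((x≢y ∷ _) ∷ u) =
  1/[ y - x ] (x≢y ∘ ≡.sym) * cellFunction (y ∷ ys) u

-- MultiIndex ℓ ℓ has a single element, standing for dt₁ ⋯ dt_ℓ.
cellForm : CyclicOrdering ℓ → Ω ℓ ℓ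
cellForm γ _ = cellFunction (cut∞ (proj₁ γ)) (cut∞-unique γ)

Ordering₀₁ : ℕ → Set
Ordering₀₁ ℓ = Ordering (ts ℓ ++ ∞ ∷ [])

⟨0,1,_⟩ : Ordering₀₁ ℓ → CyclicOrdering ℓ
⟨0,1,_⟩ {ℓ} (xs , xs↭) =
  affine 𝟎 ∷ affine 𝟏 ∷ xs ,
  prep (affine 𝟎) (↭-trans (prep (affine 𝟏) xs↭) (↭-sym (shift (affine 𝟏) (ts ℓ) (∞ ∷ []))))

cellForm₀₁ : Ordering₀₁ ℓ → Ω ℓ ℓ
cellForm₀₁ π = cellForm ⟨0,1, π ⟩

-- The set { ω_(0,1,π) } of 01 cell-forms: its elements are given by
-- orderings π, and are equal when they are equal as differential forms.
CellForms₀₁ : ℕ → Setoid 0ℓ 0ℓ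
CellForms₀₁ ℓ = On.setoid (Ω-setoid ℓ ℓ) (cellForm₀₁ {ℓ})

{-# OPTIONS --safe #-}
-- Write x for one of the coordinates of 𝔐₀,ₙ₊₁ and ~ for equality modulo exact
-- forms of top degree.  By partial fractions in x every function on 𝔐₀,ₙ₊₁ is
-- ~ a sum of simple poles r_a/(x - a), where a runs over the affine marked
-- points of 𝔐₀,ₙ and r_a is a function on 𝔐₀,ₙ.  Taking the residue along x = a
-- preserves exactness, so the classes of the r_a are well defined: in top
-- degree the cohomology of 𝔐₀,ₙ₊₁ is a direct sum of copies of that of 𝔐₀,ₙ,
-- one for each a.
--
-- In the cyclic ordering (0, 1, π), inserting x between neighbours p and q
-- multiplies the cell-function by 1/(x - p) - 1/(x - q), where 1/(x - ∞) counts
-- as 0.  The gaps available to x are the edges of the path 1, π, 0 through all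
-- the marked points, and the differences along the edges of a path ending up
-- with one vertex (here ∞) set to 0 are a basis of the span of the other
-- vertices.  Hence a basis for 𝔐₀,ₙ yields one for 𝔐₀,ₙ₊₁ by inserting x.
module Submission where

open import Defs
open import Data.Fin.Base using (Fin)
open import Data.Nat.Base using (ℕ; _≤_; _∸_; _!)
open import Data.Product.Base using (Σ-syntax)
open import Function.Bundles using (Bijection)
open import Relation.Binary.PropositionalEquality.Properties using (setoid)

open import Algebra.Bundles using (AbelianGroup; CommutativeRing)
import Algebra.Definitions.RawMonoid as RawMonoidDefs
open import Algebra.Module.Bundles using (LeftModule)
import Algebra.Properties.AbelianGroup as AbelianGroupProperties
import Algebra.Properties.CommutativeSemigroup as CommutativeSemigroupProperties
import Algebra.Properties.Group as GroupProperties
import Algebra.Properties.Ring as RingProperties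
import Algebra.Properties.Semiring.Sum as SemiringSum
open import Data.Bool.Base using (if_then_else_)
open import Data.Empty using (⊥-elim)
open import Data.Empty.Irrelevant using () renaming (⊥-elim to ⊥-elim-irr)
open import Data.Fin.Base using (zero; suc; toℕ; combine; remQuot; _↑ˡ_; _↑ʳ_)
import Data.Fin.Properties as Fin
open import Data.Integer.Base as ℤ using (ℤ; -[1+_]; +0; +[1+_]; -1ℤ) renaming (+_ to pos)
import Data.Integer.Properties as ℤ
open import Data.List.Base using (List; []; _∷_; _++_; map)
open import Data.List.Membership.Propositional using (_∈_; _∉_)
open import Data.List.Membership.Propositional.Properties
  using (∈-map⁺; ∈-map⁻; ∈-∃++; ∈-++⁺ʳ)
import Data.List.Properties as List
open import Data.List.Relation.Binary.Permutation.Propositional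
  using (_↭_; ↭-refl; ↭-sym; ↭-reflexive; ↭⇒↭ₛ; prep; swap) renaming (trans to ↭-trans)
open import Data.List.Relation.Binary.Permutation.Propositional.Properties
  using (↭-map-inv; map⁺; drop-mid; ↭-singleton-inv; ∈-resp-↭; ++⁺ʳ)
import Data.List.Relation.Binary.Permutation.Setoid.Properties as PermutationSetoid
open import Data.List.Relation.Unary.All as All using (All; []; _∷_)
import Data.List.Relation.Unary.All.Properties as All
open import Data.List.Relation.Unary.AllPairs using ([]; _∷_)
open import Data.List.Relation.Unary.Any using (here; there)
open import Data.List.Relation.Unary.Unique.Propositional using (Unique)
import Data.List.Relation.Unary.Unique.Propositional.Properties as Unique
open import Data.Nat.Base as ℕ using (zero; suc; z≤n; s≤s)
open import Data.Nat.Properties using (1+n≰n)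
open import Data.Product.Base using (∃; _×_; _,_; proj₁; proj₂)
open import Data.Rational.Base as ℚ using (ℚ; 0ℚ; 1ℚ)
import Data.Rational.Properties as ℚ
open import Data.Vec.Base as Vec using (Vec; []; _∷_; toList; insertAt)
open import Data.Vec.Functional using (Vector)
import Data.Vec.Properties as Vec
open import Function.Base using (_∘_; id)
open import Level using (Level; 0ℓ; _⊔_)
open import Relation.Binary.PropositionalEquality.Core as ≡ using (_≡_; _≢_)
import Relation.Binary.PropositionalEquality.Properties as ≡
open import Relation.Binary.PropositionalEquality.Properties using (module ≡-Reasoning)
import Relation.Binary.Reasoning.Setoid as SetoidReasoning
open import Relation.Nullary.Decidable.Core using (Dec; does; yes; no; map′)
open import Relation.Nullary.Negation.Core using (contradiction)

-- `𝒪` is given by generators and relations, so nothing in it can be shown to be nonzero by reading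
-- off a normal form: an invariant has to be defined on expressions and checked against `_≈_`. For
-- residues this is done with an action instead of a ring of series. The functions on 𝔐₀,ₙ₊₁ act on
-- Laurent series in `u = x - a` with coefficients on 𝔐₀,ₙ. Operators are needed for the generators
-- only, so series are never multiplied with one another, and inverting `x - b` amounts to solving a
-- recursion for coefficients. Applying `f` to the series 1 gives its expansion. The same induction
-- on expressions gives a Leibniz rule for each derivation, and from it the two facts that make
-- residues respect exactness: a derivative in `x` has no residue, and the other derivatives commute
-- with the residue. The induction starts at `ℓ = 0`, one step below the range of the theorem, where
-- 𝔐₀,₃ is a point and evaluation in ℚ shows that 1 is not exact.

private variable
  α ρ : Level
  ℓ k m n : ℕ

reflexive : {f g : 𝒪 ℓ} → f ≡ g → f ≈ g
reflexive ≡.refl = refl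

module ≈-Reasoning {ℓ : ℕ} = SetoidReasoning (CommutativeRing.setoid (𝒪-commutativeRing ℓ))

-- Modules over 𝒪 with a connection

module _ (M : AbelianGroup α ρ) where
  private module M = AbelianGroup M
  open M using () renaming (Carrier to ∣M∣; _≈_ to _≋_; _∙_ to _⊕_; ε to 𝟘; _⁻¹ to ⊖_)
  open GroupProperties M.group using (identityʳ-unique; inverseˡ-unique; x∙y⁻¹≈ε⇒x≈y; x≈y⇒x∙y⁻¹≈ε)

  record IsAdditive (T : ∣M∣ → ∣M∣) : Set (α ⊔ ρ) where
    field
      cong  : ∀ {m m′} → m ≋ m′ → T m ≋ T m′
      homo  : ∀ m m′ → T (m ⊕ m′) ≋ T m ⊕ T m′

    0-homo : T 𝟘 ≋ 𝟘
    0-homo = identityʳ-unique (T 𝟘) (T 𝟘)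
      (M.trans (M.sym (homo 𝟘 𝟘)) (cong (M.identityˡ 𝟘)))

    -‿homo : ∀ m → T (⊖ m) ≋ ⊖ T m
    -‿homo m = inverseˡ-unique (T (⊖ m)) (T m)
      (M.trans (M.sym (homo (⊖ m) m)) (M.trans (cong (M.inverseˡ m)) 0-homo))

  open AbelianGroupProperties M using (⁻¹-∙-comm)
  open CommutativeSemigroupProperties M.commutativeSemigroup using (interchange)

  +-additive : ∀ {S T} → IsAdditive S → IsAdditive T → IsAdditive (λ m → S m ⊕ T m)
  +-additive s s′ = record
    { cong = λ e → M.∙-cong (IsAdditive.cong s e) (IsAdditive.cong s′ e)
    ; homo = λ m m′ → M.trans (M.∙-cong (IsAdditive.homo s m m′) (IsAdditive.homo s′ m m′))
                              (interchange _ _ _ _) }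

  -‿additive : ∀ {S} → IsAdditive S → IsAdditive (λ m → ⊖ S m)
  -‿additive s = record
    { cong = λ e → M.⁻¹-cong (IsAdditive.cong s e)
    ; homo = λ m m′ → M.trans (M.⁻¹-cong (IsAdditive.homo s m m′)) (M.sym (⁻¹-∙-comm _ _)) }

  kernel⇒cancel : ∀ {T} → IsAdditive T → (∀ m → T m ≋ 𝟘 → m ≋ 𝟘) →
                  ∀ {m m′} → T m ≋ T m′ → m ≋ m′
  kernel⇒cancel T-additive kernel {m} {m′} p = x∙y⁻¹≈ε⇒x≈y m m′ (kernel _
    (M.trans (T.homo m (⊖ m′)) (M.trans (M.∙-congˡ (T.-‿homo m′)) (x≈y⇒x∙y⁻¹≈ε p))))
    where module T = IsAdditive T-additive

  Commute : (S T : ∣M∣ → ∣M∣) → Set (α ⊔ ρ)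
  Commute S T = ∀ m → S (T m) ≋ T (S m)

record Operators (k : ℕ) (M : AbelianGroup α ρ) : Set α where
  private module M = AbelianGroup M
  open M using () renaming (Carrier to ∣M∣; _∙_ to _⊕_; _⁻¹ to ⊖_)

  field
    conₘ : ℚ → ∣M∣ → ∣M∣
    varₘ : Fin k → ∣M∣ → ∣M∣
    1/ₘ  : (a b : AffinePoint k) → .(a ≢ b) → ∣M∣ → ∣M∣

  ⟦_⟧ : 𝒪 k → ∣M∣ → ∣M∣
  ⟦ con q ⟧ m = conₘ q m
  ⟦ var i ⟧ m = varₘ i m
  ⟦ f + g ⟧ m = ⟦ f ⟧ m ⊕ ⟦ g ⟧ m
  ⟦ f * g ⟧ m = ⟦ f ⟧ (⟦ g ⟧ m)
  ⟦ - f ⟧ m   = ⊖ ⟦ f ⟧ m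
  ⟦ 1/[ a - b ] a≢b ⟧ m = 1/ₘ a b a≢b m

-- Commuting additive operators on M, one for each coordinate, make M a module
-- over 𝒪 k as soon as the differences of marked points act invertibly: there
-- are no relations to check between the inverses.
record IsAction {k : ℕ} {M : AbelianGroup α ρ} (G : Operators k M) : Set (α ⊔ ρ) where
  private module M = AbelianGroup M
  open M using () renaming (Carrier to ∣M∣; _≈_ to _≋_; _∙_ to _⊕_; ε to 𝟘; _⁻¹ to ⊖_)
  open Operators G

  field
    con-additive : ∀ q → IsAdditive M (conₘ q)
    var-additive : ∀ i → IsAdditive M (varₘ i)
    con-0        : ∀ m → conₘ 0ℚ m ≋ 𝟘
    con-1        : ∀ m → conₘ 1ℚ m ≋ m
    con-+ₘ       : ∀ p q m → conₘ (p ℚ.+ q) m ≋ conₘ p m ⊕ conₘ q m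
    con-*ₘ       : ∀ p q m → conₘ (p ℚ.* q) m ≋ conₘ p (conₘ q m)
    con-var      : ∀ q i → Commute M (conₘ q) (varₘ i)
    var-var      : ∀ i j → Commute M (varₘ i) (varₘ j)
    1/-inverse   : ∀ a b .(a≢b : a ≢ b) m → ⟦ coord a + - coord b ⟧ (1/ₘ a b a≢b m) ≋ m
    cancel       : ∀ a b .(a≢b : a ≢ b) {m m′} →
                   ⟦ coord a + - coord b ⟧ m ≋ ⟦ coord a + - coord b ⟧ m′ → m ≋ m′

  open SetoidReasoning M.setoid
  open AbelianGroupProperties M using (⁻¹-∙-comm)
  open CommutativeSemigroupProperties M.commutativeSemigroup using (interchange)

  coord-additive : ∀ a → IsAdditive M ⟦ coord a ⟧
  coord-additive 𝟎     = con-additive 0ℚ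
  coord-additive 𝟏     = con-additive 1ℚ
  coord-additive (t i) = var-additive i

  difference-additive : ∀ a b → IsAdditive M ⟦ coord a + - coord b ⟧
  difference-additive a b = +-additive M (coord-additive a) (-‿additive M (coord-additive b))

  additive : ∀ f → IsAdditive M ⟦ f ⟧
  additive (con q) = con-additive q
  additive (var i) = var-additive i
  additive (f + g) = +-additive M (additive f) (additive g)
  additive (f * g) = record
    { cong = λ e → F.cong (G.cong e)
    ; homo = λ m m′ → M.trans (F.cong (G.homo m m′)) (F.homo _ _) }
    where
    module F = IsAdditive (additive f)
    module G = IsAdditive (additive g)
  additive (- f)   = -‿additive M (additive f)
  additive (1/[ a - b ] a≢b) = record
    { cong = λ e → cancel a b a≢b (M.trans (1/-inverse a b a≢b _)
               (M.trans e (M.sym (1/-inverse a b a≢b _))))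
    ; homo = λ m m′ → cancel a b a≢b (M.trans (1/-inverse a b a≢b _)
               (M.sym (M.trans (X.homo _ _)
                 (M.∙-cong (1/-inverse a b a≢b m) (1/-inverse a b a≢b m′))))) }
    where module X = IsAdditive (difference-additive a b)

  module _ {T : ∣M∣ → ∣M∣} (T-additive : IsAdditive M T)
           (T-con : ∀ q → Commute M T (conₘ q)) (T-var : ∀ i → Commute M T (varₘ i)) where
    private module T = IsAdditive T-additive

    commute-+ : ∀ {R S} → Commute M T R → Commute M T S → Commute M T (λ m → R m ⊕ S m)
    commute-+ r s m = M.trans (T.homo _ _) (M.∙-cong (r m) (s m))

    commute-‿- : ∀ {R} → Commute M T R → Commute M T (λ m → ⊖ R m)
    commute-‿- r m = M.trans (T.-‿homo _) (M.⁻¹-cong (r m))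

    commute-coord : ∀ a → Commute M T ⟦ coord a ⟧
    commute-coord 𝟎     = T-con 0ℚ
    commute-coord 𝟏     = T-con 1ℚ
    commute-coord (t i) = T-var i

    commute-difference : ∀ a b → Commute M T ⟦ coord a + - coord b ⟧
    commute-difference a b =
      commute-+ {⟦ coord a ⟧} {⟦ - coord b ⟧} (commute-coord a)
                (commute-‿- {⟦ coord b ⟧} (commute-coord b))

    -- An inverse is handled by cancelling its difference: once `⟦ coord a + - coord b ⟧` is
    -- applied, both sides become `T m`, as `T` already commutes with the difference.
    commute : ∀ f → Commute M T ⟦ f ⟧
    commute (con q) = T-con q
    commute (var i) = T-var i
    commute (f + g) = commute-+ {⟦ f ⟧} {⟦ g ⟧} (commute f) (commute g)
    commute (f * g) m = M.trans (commute f (⟦ g ⟧ m)) (IsAdditive.cong (additive f) (commute g m))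
    commute (- f)   = commute-‿- {⟦ f ⟧} (commute f)
    commute (1/[ a - b ] a≢b) m = cancel a b a≢b
      (M.trans (M.sym (commute-difference a b _))
      (M.trans (T.cong (1/-inverse a b a≢b m)) (M.sym (1/-inverse a b a≢b (T m)))))

  con-con : ∀ p q → Commute M (conₘ p) (conₘ q)
  con-con p q m = begin
    conₘ p (conₘ q m)  ≈⟨ con-*ₘ p q m ⟨
    conₘ (p ℚ.* q) m   ≡⟨ ≡.cong (λ s → conₘ s m) (ℚ.*-comm p q) ⟩
    conₘ (q ℚ.* p) m   ≈⟨ con-*ₘ q p m ⟩
    conₘ q (conₘ p m)  ∎

  -- `commute` is used on two levels: with `T` a generator it shows that `⟦ f ⟧` commutes with
  -- constants and variables, which then allows `T` to be `⟦ f ⟧` itself.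
  commutative : ∀ f g → Commute M ⟦ f ⟧ ⟦ g ⟧
  commutative f g = commute (additive f)
    (λ q m → M.sym (commute (con-additive q) (con-con q) (con-var q) f m))
    (λ i m → M.sym (commute (var-additive i) (λ q m → M.sym (con-var q i m)) (var-var i) f m)) g

  -- The action descends from expressions to functions. The real content is `*-comm`; the relation
  -- for inverses needs it too, since `1/-inverse` has its factors in the other order.
  respects : ∀ {f g} → f ≈ g → ∀ m → ⟦ f ⟧ m ≋ ⟦ g ⟧ m
  respects refl          m = M.refl
  respects (sym p)       m = M.sym (respects p m)
  respects (trans p q)   m = M.trans (respects p m) (respects q m)
  respects (+-cong p q)  m = M.∙-cong (respects p m) (respects q m)
  respects (*-cong {f} {f′} {g} {g′} p q) m =
    M.trans (IsAdditive.cong (additive f) (respects q m)) (respects p (⟦ g′ ⟧ m))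
  respects (-‿cong p)    m = M.⁻¹-cong (respects p m)
  respects (+-assoc _ _ _)  m = M.assoc _ _ _
  respects (+-comm _ _)     m = M.comm _ _
  respects (+-identityˡ _)  m = M.trans (M.∙-congʳ (con-0 m)) (M.identityˡ _)
  respects (-‿inverseˡ f)   m = M.trans (M.inverseˡ _) (M.sym (con-0 m))
  respects (*-assoc _ _ _)  m = M.refl
  respects (*-comm f g)     m = commutative f g m
  respects (*-identityˡ _)  m = con-1 _
  respects (distribˡ f _ _) m = IsAdditive.homo (additive f) _ _
  respects (con-+ p q)      m = con-+ₘ p q m
  respects (con-* p q)      m = con-*ₘ p q m
  respects (1/-inverseˡ a b a≢b) m = begin
    1/ₘ a b a≢b (⟦ coord a + - coord b ⟧ m)
      ≈⟨ commutative (1/[ a - b ] a≢b) (coord a + - coord b) m ⟩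
    ⟦ coord a + - coord b ⟧ (1/ₘ a b a≢b m)  ≈⟨ 1/-inverse a b a≢b m ⟩
    m                                        ≈⟨ con-1 m ⟨
    conₘ 1ℚ m                                ∎

  -- D is a connection along ∂ᵢ.
  module _ {D : ∣M∣ → ∣M∣} (D-additive : IsAdditive M D) (i : Fin k)
           (D-con : ∀ q → Commute M D (conₘ q))
           (D-var : ∀ j m → D (varₘ j m) ≋ varₘ j (D m) ⊕ ⟦ ∂coord i (t j) ⟧ m) where
    private module D = IsAdditive D-additive

    Leibniz : 𝒪 k → 𝒪 k → Set _
    Leibniz f f′ = ∀ m → D (⟦ f ⟧ m) ≋ ⟦ f ⟧ (D m) ⊕ ⟦ f′ ⟧ m

    leibniz-+ : ∀ f f′ g g′ → Leibniz f f′ → Leibniz g g′ → Leibniz (f + g) (f′ + g′)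
    leibniz-+ f f′ g g′ p q m =
      M.trans (D.homo _ _) (M.trans (M.∙-cong (p m) (q m)) (interchange _ _ _ _))

    leibniz-‿- : ∀ f f′ → Leibniz f f′ → Leibniz (- f) (- f′)
    leibniz-‿- f f′ p m =
      M.trans (D.-‿homo _) (M.trans (M.⁻¹-cong (p m)) (M.sym (⁻¹-∙-comm _ _)))

    leibniz-con : ∀ q → Leibniz (con q) (con 0ℚ)
    leibniz-con q m = begin
      D (conₘ q m)               ≈⟨ D-con q m ⟩
      conₘ q (D m)               ≈⟨ M.identityʳ _ ⟨
      conₘ q (D m) ⊕ 𝟘           ≈⟨ M.∙-congˡ (con-0 m) ⟨
      conₘ q (D m) ⊕ conₘ 0ℚ m   ∎

    leibniz-coord : ∀ a → Leibniz (coord a) (∂coord i a)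
    leibniz-coord 𝟎     = leibniz-con 0ℚ
    leibniz-coord 𝟏     = leibniz-con 1ℚ
    leibniz-coord (t j) = D-var j

    leibniz : ∀ f m → D (⟦ f ⟧ m) ≋ ⟦ f ⟧ (D m) ⊕ ⟦ ∂ i f ⟧ m
    leibniz (con q) = leibniz-con q
    leibniz (var j) = D-var j
    leibniz (f + g) = leibniz-+ f (∂ i f) g (∂ i g) (leibniz f) (leibniz g)
    leibniz (f * g) m = begin
      D (⟦ f ⟧ (⟦ g ⟧ m))
        ≈⟨ leibniz f (⟦ g ⟧ m) ⟩
      ⟦ f ⟧ (D (⟦ g ⟧ m)) ⊕ ⟦ ∂ i f ⟧ (⟦ g ⟧ m)
        ≈⟨ M.∙-congʳ (M.trans (F.cong (leibniz g m)) (F.homo _ _)) ⟩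
      (⟦ f * g ⟧ (D m) ⊕ ⟦ f * ∂ i g ⟧ m) ⊕ ⟦ ∂ i f * g ⟧ m
        ≈⟨ M.assoc _ _ _ ⟩
      ⟦ f * g ⟧ (D m) ⊕ (⟦ f * ∂ i g ⟧ m ⊕ ⟦ ∂ i f * g ⟧ m)
        ≈⟨ M.∙-congˡ (M.comm _ _) ⟩
      ⟦ f * g ⟧ (D m) ⊕ (⟦ ∂ i f * g ⟧ m ⊕ ⟦ f * ∂ i g ⟧ m) ∎
      where module F = IsAdditive (additive f)
    leibniz (- f) = leibniz-‿- f (∂ i f) (leibniz f)
    -- The quotient rule: apply the rule for `X` to `⟦ u ⟧ m`, which `X` sends back to `m`, and
    -- solve for `D (⟦ u ⟧ m)`.
    leibniz (1/[ a - b ] a≢b) m = cancel a b a≢b (begin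
      ⟦ X ⟧ (D (⟦ u ⟧ m))
        ≈⟨ M.identityʳ _ ⟨
      ⟦ X ⟧ (D (⟦ u ⟧ m)) ⊕ 𝟘
        ≈⟨ M.∙-congˡ (M.inverseʳ (⟦ X′ ⟧ (⟦ u ⟧ m))) ⟨
      ⟦ X ⟧ (D (⟦ u ⟧ m)) ⊕ (⟦ X′ ⟧ (⟦ u ⟧ m) ⊕ ⊖ ⟦ X′ ⟧ (⟦ u ⟧ m))
        ≈⟨ M.assoc _ _ _ ⟨
      (⟦ X ⟧ (D (⟦ u ⟧ m)) ⊕ ⟦ X′ ⟧ (⟦ u ⟧ m)) ⊕ ⊖ ⟦ X′ ⟧ (⟦ u ⟧ m)
        ≈⟨ M.∙-congʳ (leibniz-X (⟦ u ⟧ m)) ⟨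
      D (⟦ X ⟧ (⟦ u ⟧ m)) ⊕ ⊖ ⟦ X′ ⟧ (⟦ u ⟧ m)
        ≈⟨ M.∙-cong (D.cong (1/-inverse a b a≢b m)) (M.⁻¹-cong (commutative X′ u m)) ⟩
      D m ⊕ ⊖ ⟦ u ⟧ (⟦ X′ ⟧ m)
        ≈⟨ M.∙-cong (1/-inverse a b a≢b (D m)) (M.⁻¹-cong (1/-inverse a b a≢b _)) ⟨
      ⟦ X ⟧ (⟦ u ⟧ (D m)) ⊕ ⊖ ⟦ X ⟧ (⟦ u ⟧ (⟦ u ⟧ (⟦ X′ ⟧ m)))
        ≈⟨ M.∙-congˡ (𝕏.-‿homo _) ⟨
      ⟦ X ⟧ (⟦ u ⟧ (D m)) ⊕ ⟦ X ⟧ (⊖ ⟦ u ⟧ (⟦ u ⟧ (⟦ X′ ⟧ m)))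
        ≈⟨ 𝕏.homo _ _ ⟨
      ⟦ X ⟧ (⟦ u ⟧ (D m) ⊕ ⊖ ⟦ u ⟧ (⟦ u ⟧ (⟦ X′ ⟧ m))) ∎)
      where
      u  = 1/[ a - b ] a≢b
      X  = coord a + - coord b
      X′ = ∂coord i a + - ∂coord i b
      module 𝕏 = IsAdditive (additive X)
      leibniz-X = leibniz-+ (coord a) (∂coord i a) (- coord b) (- ∂coord i b)
        (leibniz-coord a) (leibniz-‿- (coord b) (∂coord i b) (leibniz-coord b))

-- Marked points and the map forgetting one of them

module _ {ℓ : ℕ} where
  infix 4 _≟ᵃ_
  _≟ᵃ_ : (a b : AffinePoint ℓ) → Dec (a ≡ b)
  𝟎   ≟ᵃ 𝟎   = yes ≡.refl
  𝟎   ≟ᵃ 𝟏   = no λ ()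
  𝟎   ≟ᵃ t _ = no λ ()
  𝟏   ≟ᵃ 𝟎   = no λ ()
  𝟏   ≟ᵃ 𝟏   = yes ≡.refl
  𝟏   ≟ᵃ t _ = no λ ()
  t _ ≟ᵃ 𝟎   = no λ ()
  t _ ≟ᵃ 𝟏   = no λ ()
  t i ≟ᵃ t j = map′ (≡.cong t) (λ { ≡.refl → ≡.refl }) (i Fin.≟ j)

-- Forgetting the point x = t zero maps 𝔐₀,ₙ₊₁ to 𝔐₀,ₙ; the points of
-- the latter are relabelled along liftᵃ.
pattern x = t zero

liftᵃ : AffinePoint ℓ → AffinePoint (suc ℓ)
liftᵃ 𝟎     = 𝟎
liftᵃ 𝟏     = 𝟏
liftᵃ (t i) = t (suc i)

liftᵃ-injective : ∀ {a b : AffinePoint ℓ} → liftᵃ a ≡ liftᵃ b → a ≡ b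
liftᵃ-injective {a = 𝟎}   {𝟎}    _      = ≡.refl
liftᵃ-injective {a = 𝟏}   {𝟏}    _      = ≡.refl
liftᵃ-injective {a = t _} {t ._} ≡.refl = ≡.refl

liftᵃ≢x : ∀ {a : AffinePoint ℓ} → x ≢ liftᵃ a
liftᵃ≢x {a = 𝟎}   ()
liftᵃ≢x {a = 𝟏}   ()
liftᵃ≢x {a = t _} ()

data Lifted {ℓ : ℕ} : AffinePoint (suc ℓ) → Set where
  new : Lifted x
  old : ∀ a → Lifted (liftᵃ a)

lifted : (a : AffinePoint (suc ℓ)) → Lifted a
lifted 𝟎           = old 𝟎
lifted 𝟏           = old 𝟏
lifted x           = new
lifted (t (suc i)) = old (t i)

-- Pullback of functions along the forgetful map. It works on expressions, so that `ι-∂` holds as a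
-- propositional equality.
ι : 𝒪 ℓ → 𝒪 (suc ℓ)
ι (con q) = con q
ι (var i) = var (suc i)
ι (f + g) = ι f + ι g
ι (f * g) = ι f * ι g
ι (- f)   = - ι f
ι (1/[ a - b ] a≢b) = 1/[ liftᵃ a - liftᵃ b ] (a≢b ∘ liftᵃ-injective)

ι-coord : ∀ (a : AffinePoint ℓ) → ι (coord a) ≡ coord (liftᵃ a)
ι-coord 𝟎     = ≡.refl
ι-coord 𝟏     = ≡.refl
ι-coord (t _) = ≡.refl

ι-cong : ∀ {f g : 𝒪 ℓ} → f ≈ g → ι f ≈ ι g
ι-cong refl               = refl
ι-cong (sym p)            = sym (ι-cong p)
ι-cong (trans p q)        = trans (ι-cong p) (ι-cong q)
ι-cong (+-cong p q)       = +-cong (ι-cong p) (ι-cong q)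
ι-cong (*-cong p q)       = *-cong (ι-cong p) (ι-cong q)
ι-cong (-‿cong p)         = -‿cong (ι-cong p)
ι-cong (+-assoc _ _ _)    = +-assoc _ _ _
ι-cong (+-comm _ _)       = +-comm _ _
ι-cong (+-identityˡ _)    = +-identityˡ _
ι-cong (-‿inverseˡ _)     = -‿inverseˡ _
ι-cong (*-assoc _ _ _)    = *-assoc _ _ _
ι-cong (*-comm _ _)       = *-comm _ _
ι-cong (*-identityˡ _)    = *-identityˡ _
ι-cong (distribˡ _ _ _)   = distribˡ _ _ _
ι-cong (con-+ _ _)        = con-+ _ _
ι-cong (con-* _ _)        = con-* _ _
ι-cong (1/-inverseˡ a b a≢b) rewrite ι-coord a | ι-coord b =
  1/-inverseˡ (liftᵃ a) (liftᵃ b) (a≢b ∘ liftᵃ-injective)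

e : AffinePoint ℓ → 𝒪 (suc ℓ)
e a = 1/[ x - liftᵃ a ] liftᵃ≢x

δ : (a b : AffinePoint ℓ) → ℚ
δ a b = if does (a ≟ᵃ b) then 1ℚ else 0ℚ

-- Moving by 1 at each step makes `fromℤ-suc`, on which the Leibniz rule for `d/du` rests, nearly
-- definitional.
fromℤ : ℤ → ℚ
fromℤ +0           = 0ℚ
fromℤ +[1+ n ]     = fromℤ (pos n) ℚ.+ 1ℚ
fromℤ -[1+ zero ]  = ℚ.- 1ℚ
fromℤ -[1+ suc n ] = fromℤ -[1+ n ] ℚ.- 1ℚ

fromℤ-suc : ∀ k → fromℤ (ℤ.suc k) ≡ fromℤ k ℚ.+ 1ℚ
fromℤ-suc (pos n)      = ≡.refl
fromℤ-suc -[1+ zero ]  = ≡.refl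
fromℤ-suc -[1+ suc n ] = ≡.sym (≡.trans (ℚ.+-assoc (fromℤ -[1+ n ]) (ℚ.- 1ℚ) 1ℚ)
  (≡.trans (≡.cong (fromℤ -[1+ n ] ℚ.+_) (ℚ.+-inverseˡ 1ℚ)) (ℚ.+-identityʳ _)))

-- Laurent series and residues

-- Σ coeff k uᵏ
record Laurent (ℓ : ℕ) : Set where
  field
    coeff  : ℤ → 𝒪 ℓ
    bound  : ℤ
    vanish : ∀ {k} → k ℤ.≤ bound → coeff k ≈ con 0ℚ

open Laurent

module _ {ℓ : ℕ} where
  open 𝒪-Ring {ℓ}
  open ≈-Reasoning

  infix 4 _≈ᴸ_
  -- Equal series may come with different bounds. The record keeps `m` and `m′` inferable from the
  -- type of a proof, which a bare function type would not.
  record _≈ᴸ_ (m m′ : Laurent ℓ) : Set where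
    constructor coeffwise
    field at : ∀ k → coeff m k ≈ coeff m′ k
  open _≈ᴸ_ public

  infixl 6 _+ᴸ_
  _+ᴸ_ : Laurent ℓ → Laurent ℓ → Laurent ℓ
  m +ᴸ m′ = record
    { coeff  = λ k → coeff m k + coeff m′ k
    ; bound  = bound m ℤ.⊓ bound m′
    ; vanish = λ k≤ → trans (+-cong (vanish m (ℤ.≤-trans k≤ (ℤ.i⊓j≤i _ _)))
                                    (vanish m′ (ℤ.≤-trans k≤ (ℤ.i⊓j≤j (bound m) _))))
                            (+-identityˡ _) }

  laurentGroup : AbelianGroup 0ℓ 0ℓ
  laurentGroup = record
    { Carrier = Laurent ℓ ; _≈_ = _≈ᴸ_ ; _∙_ = _+ᴸ_
    ; ε   = record { coeff = λ _ → con 0ℚ ; bound = +0 ; vanish = λ _ → refl }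
    ; _⁻¹ = λ m → record
      { coeff = λ k → - coeff m k ; bound = bound m
      ; vanish = λ k≤ → trans (-‿cong (vanish m k≤)) -0#≈0# }
    ; isAbelianGroup = record
      { isGroup = record
        { isMonoid = record
          { isSemigroup = record
            { isMagma = record
              { isEquivalence = record
                { refl  = coeffwise λ _ → refl
                ; sym   = λ p → coeffwise λ k → sym (at p k)
                ; trans = λ p q → coeffwise λ k → trans (at p k) (at q k) }
              ; ∙-cong = λ p q → coeffwise λ k → +-cong (at p k) (at q k) }
            ; assoc = λ _ _ _ → coeffwise λ _ → +-assoc _ _ _ }
          ; identity = (λ _ → coeffwise λ _ → +-identityˡ _)
                     , (λ _ → coeffwise λ _ → +-identityʳ _) }
        ; inverse = (λ _ → coeffwise λ _ → -‿inverseˡ _)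
                  , (λ _ → coeffwise λ _ → -‿inverseʳ _)
        ; ⁻¹-cong = λ p → coeffwise λ k → -‿cong (at p k) }
      ; comm = λ _ _ → coeffwise λ _ → +-comm _ _ } }

  private module L = AbelianGroup laurentGroup

  scale : 𝒪 ℓ → Laurent ℓ → Laurent ℓ
  scale f m = record
    { coeff = λ k → f * coeff m k ; bound = bound m
    ; vanish = λ k≤ → trans (*-congˡ (vanish m k≤)) (zeroʳ f) }

  u∙ u⁻¹∙ d/du : Laurent ℓ → Laurent ℓ
  u∙ m = record
    { coeff = λ k → coeff m (ℤ.pred k) ; bound = ℤ.suc (bound m)
    ; vanish = λ k≤ → vanish m (ℤ.≤-trans (ℤ.pred-mono k≤) (ℤ.≤-reflexive (ℤ.pred-suc _))) }
  u⁻¹∙ m = record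
    { coeff = λ k → coeff m (ℤ.suc k) ; bound = ℤ.pred (bound m)
    ; vanish = λ k≤ → vanish m (ℤ.≤-trans (ℤ.suc-mono k≤) (ℤ.≤-reflexive (ℤ.suc-pred _))) }
  d/du m = record
    { coeff = λ k → con (fromℤ (ℤ.suc k)) * coeff m (ℤ.suc k) ; bound = bound (u⁻¹∙ m)
    ; vanish = λ k≤ → trans (*-congˡ (vanish (u⁻¹∙ m) k≤)) (zeroʳ _) }

  ∂ᴸ : Fin ℓ → Laurent ℓ → Laurent ℓ
  ∂ᴸ i m = record
    { coeff = λ k → ∂ i (coeff m k) ; bound = bound m
    ; vanish = λ k≤ → ∂-cong i (vanish m k≤) }

  1ᴸ : Laurent ℓ
  1ᴸ = record { coeff = one ; bound = -1ℤ ; vanish = λ { (ℤ.-≤- _) → refl } }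
    where
    one : ℤ → 𝒪 ℓ
    one +0       = con 1ℚ
    one +[1+ _ ] = con 0ℚ
    one -[1+ _ ] = con 0ℚ

  private
    i+[j-i]≡j : ∀ i j → i ℤ.+ (j ℤ.- i) ≡ j
    i+[j-i]≡j i j = ≡.trans (ℤ.+-comm i _) (≡.trans (ℤ.+-assoc j (ℤ.- i) i)
      (≡.trans (≡.cong (λ l → j ℤ.+ l) (ℤ.+-inverseˡ i)) (ℤ.+-identityʳ j)))

  -- (c + u)⁻¹, where v = c⁻¹; the index of quotient is relative to the bound.
  module _ (v : 𝒪 ℓ) (m : Laurent ℓ) where
    quotient : ℤ → 𝒪 ℓ
    quotient +0       = con 0ℚ
    quotient +[1+ n ] = v * (coeff m (bound m ℤ.+ +[1+ n ]) + - quotient (pos n))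
    quotient -[1+ _ ] = con 0ℚ

    quotient-vanish : ∀ {k} → k ℤ.≤ +0 → quotient k ≈ con 0ℚ
    quotient-vanish (ℤ.+≤+ z≤n) = refl
    quotient-vanish ℤ.-≤+ = refl

    quotient-step : ∀ {c} → v * c ≈ con 1ℚ → ∀ i →
                    c * quotient i + quotient (ℤ.pred i) ≈ coeff m (bound m ℤ.+ i)
    quotient-step {c} vc≈1 +[1+ n ] =
      trans (solve 4 (λ v c s q → (c :* (v :* (s :+ :- q)) :+ q)
                               := ((v :* c) :* (s :+ :- q) :+ q))
                   refl v c (coeff m (bound m ℤ.+ +[1+ n ])) (quotient (pos n)))
      (trans (+-cong (trans (*-congʳ vc≈1) (*-identityˡ _)) refl)
             (solve 2 (λ s q → ((s :+ :- q) :+ q) := s) refl _ _))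
    quotient-step vc≈1 +0 =
      trans (+-cong (zeroʳ _) refl) (trans (+-identityˡ _)
        (sym (vanish m (ℤ.≤-reflexive (ℤ.+-identityʳ _)))))
    quotient-step vc≈1 -[1+ n ] =
      trans (+-cong (zeroʳ _) refl) (trans (+-identityˡ _)
        (sym (vanish m (ℤ.i-j≤i (bound m) +[1+ n ]))))

    divide : Laurent ℓ
    divide = record
      { coeff = λ k → quotient (k ℤ.- bound m) ; bound = bound m
      ; vanish = λ k≤ → quotient-vanish (ℤ.i≤j⇒i-j≤0 k≤) }

    divide-step : ∀ {c} → v * c ≈ con 1ℚ → scale c divide +ᴸ u∙ divide ≈ᴸ m
    at (divide-step vc≈1) k =
      trans (+-cong refl (reflexive (≡.cong quotient (ℤ.pred-+ k (ℤ.- bound m)))))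
      (trans (quotient-step vc≈1 (k ℤ.- bound m))
             (reflexive (≡.cong (coeff m) (i+[j-i]≡j (bound m) k))))

  scale-additive : ∀ f → IsAdditive laurentGroup (scale f)
  scale-additive f = record
    { cong = λ p → coeffwise λ k → *-congˡ (at p k)
    ; homo = λ _ _ → coeffwise λ _ → distribˡ _ _ _ }

  u∙-additive : IsAdditive laurentGroup u∙
  u∙-additive = record
    { cong = λ p → coeffwise λ k → at p (ℤ.pred k) ; homo = λ _ _ → coeffwise λ _ → refl }

  d/du-additive : IsAdditive laurentGroup d/du
  d/du-additive = record
    { cong = λ p → coeffwise λ k → *-congˡ (at p (ℤ.suc k))
    ; homo = λ _ _ → coeffwise λ _ → distribˡ _ _ _ }

  ∂ᴸ-additive : ∀ i → IsAdditive laurentGroup (∂ᴸ i)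
  ∂ᴸ-additive i = record
    { cong = λ p → coeffwise λ k → ∂-cong i (at p k) ; homo = λ _ _ → coeffwise λ _ → refl }

  *-cancel-0 : ∀ {v c f} → v * c ≈ con 1ℚ → c * f ≈ con 0ℚ → f ≈ con 0ℚ
  *-cancel-0 {v} {c} {f} vc≈1 p = begin
    f            ≈⟨ *-identityˡ f ⟨
    con 1ℚ * f   ≈⟨ *-congʳ vc≈1 ⟨
    v * c * f    ≈⟨ *-assoc v c f ⟩
    v * (c * f)  ≈⟨ *-congˡ p ⟩
    v * con 0ℚ   ≈⟨ zeroʳ v ⟩
    con 0ℚ       ∎

  scale-kernel : ∀ {v c} → v * c ≈ con 1ℚ → ∀ m → scale c m ≈ᴸ L.ε → m ≈ᴸ L.ε
  at (scale-kernel vc≈1 m p) k = *-cancel-0 vc≈1 (at p k)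

  u∙-kernel : ∀ m → u∙ m ≈ᴸ L.ε → m ≈ᴸ L.ε
  at (u∙-kernel m p) k = trans (reflexive (≡.cong (coeff m) (≡.sym (ℤ.pred-suc k)))) (at p (ℤ.suc k))

  -- The coefficients satisfy `c sₖ + sₖ₋₁ = 0`, so vanishing propagates upwards from the bound.
  -- Boundedness is essential: a series infinite in both directions with `sₖ = - sₖ₋₁ / c` is killed
  -- by `c + u`.
  scale+u∙-kernel : ∀ {v c} → v * c ≈ con 1ℚ → ∀ m → scale c m +ᴸ u∙ m ≈ᴸ L.ε → m ≈ᴸ L.ε
  at (scale+u∙-kernel {v} {c} vc≈1 m p) k =
    trans (reflexive (≡.cong (coeff m) (≡.sym (i+[j-i]≡j (bound m) k)))) (everywhere (k ℤ.- bound m))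
    where
    above : ∀ n → coeff m (bound m ℤ.+ pos n) ≈ con 0ℚ
    above zero    = vanish m (ℤ.≤-reflexive (ℤ.+-identityʳ _))
    above (suc n) = *-cancel-0 vc≈1 (begin
      c * s                                                    ≈⟨ +-identityʳ _ ⟨
      c * s + con 0ℚ                                           ≈⟨ +-congˡ (above n) ⟨
      c * s + coeff m (bound m ℤ.+ pos n)
        ≈⟨ +-congˡ (reflexive (≡.cong (coeff m) (ℤ.+-pred (bound m) +[1+ n ]))) ⟩
      c * s + coeff m (ℤ.pred (bound m ℤ.+ +[1+ n ]))          ≈⟨ at p _ ⟩
      con 0ℚ                                                   ∎)
      where s = coeff m (bound m ℤ.+ +[1+ n ])
    everywhere : ∀ i → coeff m (bound m ℤ.+ i) ≈ con 0ℚ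
    everywhere (pos n)  = above n
    everywhere -[1+ n ] = vanish m (ℤ.i-j≤i (bound m) +[1+ n ])

  -- The expansion of functions on 𝔐₀,ₙ₊₁ in powers of u = x - a.
  module _ (a : AffinePoint ℓ) where

    -- As `x - b = (a - b) + u`, dividing by it is a shift if `a = b`, and otherwise division by a
    -- series with invertible constant term.
    pole : (b : AffinePoint ℓ) → Laurent ℓ → Laurent ℓ
    pole b m with a ≟ᵃ b
    ... | yes _  = u⁻¹∙ m
    ... | no a≢b = divide (1/[ a - b ] a≢b) m

    inverse : ∀ {p q : AffinePoint (suc ℓ)} → Lifted p → Lifted q → .(p ≢ q) → Laurent ℓ → Laurent ℓ
    inverse (old b) (old c) b≢c m = scale (1/[ b - c ] (b≢c ∘ ≡.cong liftᵃ)) m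
    inverse new     (old b) _   m = pole b m
    inverse (old b) new     _   m = pole b m L.⁻¹
    inverse new     new     x≢x m = ⊥-elim-irr (x≢x ≡.refl)

    expansion : Operators (suc ℓ) laurentGroup
    expansion = record
      { conₘ = λ q → scale (con q)
      ; varₘ = λ { zero m → scale (coord a) m +ᴸ u∙ m ; (suc i) → scale (var i) }
      ; 1/ₘ  = λ p q → inverse (lifted p) (lifted q) }

    open Operators expansion

    ⟦coord⟧ : ∀ b m → ⟦ coord (liftᵃ b) ⟧ m ≡ scale (coord b) m
    ⟦coord⟧ 𝟎     m = ≡.refl
    ⟦coord⟧ 𝟏     m = ≡.refl
    ⟦coord⟧ (t _) m = ≡.refl

    ⟦old-old⟧ : ∀ b c m → ⟦ coord (liftᵃ b) + - coord (liftᵃ c) ⟧ m ≈ᴸ scale (coord b + - coord c) m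
    at (⟦old-old⟧ b c m) k rewrite ⟦coord⟧ b m | ⟦coord⟧ c m =
      solve 3 (λ b c s → (b :* s :+ :- (c :* s)) := ((b :+ :- c) :* s)) refl (coord b) (coord c) (coeff m k)

    ⟦new-old⟧ : ∀ b m → ⟦ coord x + - coord (liftᵃ b) ⟧ m ≈ᴸ scale (coord a + - coord b) m +ᴸ u∙ m
    at (⟦new-old⟧ b m) k rewrite ⟦coord⟧ b m =
      solve 4 (λ a b s s′ → ((a :* s :+ s′) :+ :- (b :* s)) := ((a :+ :- b) :* s :+ s′)) refl
        (coord a) (coord b) (coeff m k) (coeff m (ℤ.pred k))

    ⟦new-a⟧ : ∀ {b} → a ≡ b → ∀ m → ⟦ coord x + - coord (liftᵃ b) ⟧ m ≈ᴸ u∙ m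
    at (⟦new-a⟧ {b} ≡.refl m) k = trans (at (⟦new-old⟧ b m) k)
      (trans (+-cong (trans (*-congʳ (-‿inverseʳ _)) (zeroˡ _)) refl) (+-identityˡ _))

    ⟦old-new⟧ : ∀ b m → ⟦ coord (liftᵃ b) + - coord x ⟧ m ≈ᴸ ⟦ coord x + - coord (liftᵃ b) ⟧ m L.⁻¹
    at (⟦old-new⟧ b m) k rewrite ⟦coord⟧ b m =
      solve 3 (λ b s s′ → (b :+ :- (s :+ s′)) := (:- ((s :+ s′) :+ :- b))) refl
        (coord b * coeff m k) (coord a * coeff m k) (coeff m (ℤ.pred k))

    pole-inverse : ∀ b m → ⟦ coord x + - coord (liftᵃ b) ⟧ (pole b m) ≈ᴸ m
    pole-inverse b m with a ≟ᵃ b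
    ... | yes a≡b = L.trans (⟦new-a⟧ a≡b (u⁻¹∙ m))
                      (coeffwise λ k → reflexive (≡.cong (coeff m) (ℤ.suc-pred k)))
    ... | no a≢b  = L.trans (⟦new-old⟧ b _) (divide-step _ m (1/-inverseˡ a b a≢b))

    new-old-kernel : ∀ b m → ⟦ coord x + - coord (liftᵃ b) ⟧ m ≈ᴸ L.ε → m ≈ᴸ L.ε
    new-old-kernel b m p with a ≟ᵃ b
    ... | yes a≡b = u∙-kernel m (L.trans (L.sym (⟦new-a⟧ a≡b m)) p)
    ... | no a≢b  = scale+u∙-kernel (1/-inverseˡ a b a≢b) m (L.trans (L.sym (⟦new-old⟧ b m)) p)

    var-additiveᴸ : ∀ i → IsAdditive laurentGroup ⟦ var i ⟧
    var-additiveᴸ zero    = +-additive laurentGroup (scale-additive (coord a)) u∙-additive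
    var-additiveᴸ (suc i) = scale-additive (var i)

    scale-scale : ∀ f g → Commute laurentGroup (scale f) (scale g)
    at (scale-scale f g m) k =
      solve 3 (λ f g s → (f :* (g :* s)) := (g :* (f :* s))) refl f g (coeff m k)

    scale-var : ∀ f i → Commute laurentGroup (scale f) ⟦ var i ⟧
    at (scale-var f zero m) k =
      solve 4 (λ f a s s′ → (f :* (a :* s :+ s′)) := (a :* (f :* s) :+ f :* s′)) refl
        f (coord a) (coeff m k) (coeff m (ℤ.pred k))
    scale-var f (suc i) m = scale-scale f (var i) m

    var-varᴸ : ∀ i j → Commute laurentGroup ⟦ var i ⟧ ⟦ var j ⟧
    var-varᴸ zero    zero    m = L.refl
    var-varᴸ zero    (suc j) m = L.sym (scale-var (var j) zero m)
    var-varᴸ (suc i) j       m = scale-var (var i) j m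

    difference-additiveᴸ : ∀ p q → IsAdditive laurentGroup ⟦ coord p + - coord q ⟧
    difference-additiveᴸ p q =
      +-additive laurentGroup (coord-additiveᴸ p) (-‿additive laurentGroup (coord-additiveᴸ q))
      where
      coord-additiveᴸ : ∀ p → IsAdditive laurentGroup ⟦ coord p ⟧
      coord-additiveᴸ 𝟎     = scale-additive (con 0ℚ)
      coord-additiveᴸ 𝟏     = scale-additive (con 1ℚ)
      coord-additiveᴸ (t i) = var-additiveᴸ i

    inverseᴸ : ∀ {p q} (p′ : Lifted p) (q′ : Lifted q) .(p≢q : p ≢ q) m →
               ⟦ coord p + - coord q ⟧ (inverse p′ q′ p≢q m) ≈ᴸ m
    inverseᴸ new     new     x≢x m = ⊥-elim-irr (x≢x ≡.refl)
    inverseᴸ new     (old b) _   m = pole-inverse b m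
    inverseᴸ (old b) new     _   m = L.trans (⟦old-new⟧ b _)
      (L.trans (L.⁻¹-cong (L.trans (X.-‿homo _) (L.⁻¹-cong (pole-inverse b m))))
               (⁻¹-involutive m))
      where
      module X = IsAdditive (difference-additiveᴸ x (liftᵃ b))
      open GroupProperties L.group using (⁻¹-involutive)
    at (inverseᴸ (old b) (old c) b≢c m) k = trans (at (⟦old-old⟧ b c _) k)
      (trans (solve 3 (λ d v s → (d :* (v :* s)) := ((v :* d) :* s)) refl
               (coord b + - coord c) (1/[ b - c ] (b≢c ∘ ≡.cong liftᵃ)) (coeff m k))
      (trans (*-congʳ (1/-inverseˡ b c _)) (*-identityˡ _)))

    kernelᴸ : ∀ {p q} (p′ : Lifted p) (q′ : Lifted q) → .(p ≢ q) → ∀ m →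
              ⟦ coord p + - coord q ⟧ m ≈ᴸ L.ε → m ≈ᴸ L.ε
    kernelᴸ new     new     x≢x m _ = ⊥-elim-irr (x≢x ≡.refl)
    kernelᴸ new     (old b) _   m e = new-old-kernel b m e
    kernelᴸ (old b) new     _   m e = new-old-kernel b m
      (⁻¹-injective (L.trans (L.sym (⟦old-new⟧ b m)) (L.trans e (L.sym ε⁻¹≈ε))))
      where open GroupProperties L.group using (⁻¹-injective; ε⁻¹≈ε)
    kernelᴸ (old b) (old c) b≢c m e =
      scale-kernel (1/-inverseˡ b c (b≢c ∘ ≡.cong liftᵃ)) m (L.trans (L.sym (⟦old-old⟧ b c m)) e)

    isAction : IsAction expansion
    isAction = record
      { con-additive = λ q → scale-additive (con q)
      ; var-additive = var-additiveᴸ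
      ; con-0        = λ _ → coeffwise λ _ → zeroˡ _
      ; con-1        = λ _ → coeffwise λ _ → *-identityˡ _
      ; con-+ₘ       = λ p q _ → coeffwise λ _ → trans (*-congʳ (con-+ p q)) (distribʳ _ _ _)
      ; con-*ₘ       = λ p q _ → coeffwise λ _ → trans (*-congʳ (con-* p q)) (*-assoc _ _ _)
      ; con-var      = λ q → scale-var (con q)
      ; var-var      = var-varᴸ
      ; 1/-inverse   = λ p q → inverseᴸ (lifted p) (lifted q)
      ; cancel       = λ p q p≢q → kernel⇒cancel laurentGroup (difference-additiveᴸ p q)
                                     (kernelᴸ (lifted p) (lifted q) p≢q)
      }

    open IsAction isAction using (respects; additive; leibniz)

    fromℤ-suc-* : ∀ k f → con (fromℤ (ℤ.suc k)) * f ≈ con (fromℤ k) * f + f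
    fromℤ-suc-* k f rewrite fromℤ-suc k =
      trans (*-congʳ (con-+ (fromℤ k) 1ℚ)) (trans (distribʳ _ _ _) (+-congˡ (*-identityˡ _)))

    d/du-con : ∀ q → Commute laurentGroup d/du (scale (con q))
    at (d/du-con q m) k =
      solve 3 (λ z q s → (z :* (q :* s)) := (q :* (z :* s))) refl
        (con (fromℤ (ℤ.suc k))) (con q) (coeff m (ℤ.suc k))

    d/du-var : ∀ j m → d/du (⟦ var j ⟧ m) ≈ᴸ ⟦ var j ⟧ (d/du m) +ᴸ ⟦ ∂coord zero (t j) ⟧ m
    -- The shift by `u` contributes `(k + 1) sₖ = k sₖ + sₖ`; the last summand is the term with the
    -- derivative of `x`.
    at (d/du-var zero m) k rewrite ℤ.pred-suc k | ℤ.suc-pred k =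
      trans (distribˡ _ _ _)
      (trans (+-congˡ (fromℤ-suc-* k (coeff m k)))
      (trans (solve 5 (λ z w a s s′ → (w :* (a :* s′) :+ (z :* s :+ s)) := ((a :* (w :* s′) :+ z :* s) :+ s))
                refl (con (fromℤ k)) (con (fromℤ (ℤ.suc k))) (coord a) (coeff m k) (coeff m (ℤ.suc k)))
             (+-congˡ (sym (*-identityˡ _)))))
    at (d/du-var (suc j) m) k =
      trans (solve 3 (λ z q s → (z :* (q :* s)) := (q :* (z :* s))) refl
              (con (fromℤ (ℤ.suc k))) (var j) (coeff m (ℤ.suc k)))
            (sym (trans (+-cong refl (zeroˡ _)) (+-identityʳ _)))

    -- As x = a + u, keeping x constant makes u vary by -∂ᵢa.
    ∇ : Fin ℓ → Laurent ℓ → Laurent ℓ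
    ∇ i m = ∂ᴸ i m +ᴸ scale (∂coord i a) (d/du m) L.⁻¹

    ∇-additive : ∀ i → IsAdditive laurentGroup (∇ i)
    ∇-additive i = +-additive laurentGroup (∂ᴸ-additive i)
      (-‿additive laurentGroup (record
        { cong = λ e → S.cong (IsAdditive.cong d/du-additive e)
        ; homo = λ m m′ → L.trans (S.cong (IsAdditive.homo d/du-additive m m′)) (S.homo (d/du m) (d/du m′)) }))
      where module S = IsAdditive (scale-additive (∂coord i a))

    ∂-coord : ∀ i (b : AffinePoint ℓ) → ∂ i (coord b) ≡ ∂coord i b
    ∂-coord i 𝟎     = ≡.refl
    ∂-coord i 𝟏     = ≡.refl
    ∂-coord i (t _) = ≡.refl

    ∇-con : ∀ i q → Commute laurentGroup (∇ i) (scale (con q))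
    at (∇-con i q m) k =
      trans (+-cong (trans (+-cong (zeroˡ _) refl) (+-identityˡ _)) refl)
        (solve 5 (λ q z a s s′ → (q :* s :+ :- (a :* (z :* (q :* s′))))
                              := (q :* (s :+ :- (a :* (z :* s′))))) refl
          (con q) (con (fromℤ (ℤ.suc k))) (∂coord i a) (∂ i (coeff m k)) (coeff m (ℤ.suc k)))

    -- For `j = zero` the operator is `a + u`: the derivative of `a` cancels against the variation
    -- of `u`, in accordance with `x` being constant along the other coordinates.
    ∇-var : ∀ i j m → ∇ i (⟦ var j ⟧ m) ≈ᴸ ⟦ var j ⟧ (∇ i m) +ᴸ ⟦ ∂coord (suc i) (t j) ⟧ m
    at (∇-var i zero m) k rewrite ℤ.pred-suc k | ℤ.suc-pred k | ∂-coord i a =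
      trans (+-congˡ (-‿cong (*-congˡ (trans (distribˡ _ _ _) (+-congˡ (fromℤ-suc-* k (coeff m k)))))))
      (trans (solve 8 (λ a a′ s s′ ds ds₋ z w →
                 (((a′ :* s :+ a :* ds) :+ ds₋) :+ :- (a′ :* (w :* (a :* s′) :+ (z :* s :+ s))))
              := (a :* (ds :+ :- (a′ :* (w :* s′))) :+ (ds₋ :+ :- (a′ :* (z :* s)))))
               refl (coord a) (∂coord i a) (coeff m k) (coeff m (ℤ.suc k)) (∂ i (coeff m k))
               (∂ i (coeff m (ℤ.pred k))) (con (fromℤ k)) (con (fromℤ (ℤ.suc k))))
      (sym (trans (+-congˡ (zeroˡ _)) (+-identityʳ _))))
    at (∇-var i (suc j) m) k =
      solve 7 (λ t t′ z a s s′ ds → ((t′ :* s :+ t :* ds) :+ :- (a :* (z :* (t :* s′))))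
                := (t :* (ds :+ :- (a :* (z :* s′))) :+ t′ :* s)) refl
          (var j) (∂coord i (t j)) (con (fromℤ (ℤ.suc k))) (∂coord i a)
          (coeff m k) (coeff m (ℤ.suc k)) (∂ i (coeff m k))

    -- `⟦ f ⟧ 1ᴸ` is the Laurent expansion of `f` along `x = a`.
    residue : 𝒪 (suc ℓ) → 𝒪 ℓ
    residue f = coeff (⟦ f ⟧ 1ᴸ) -1ℤ

    residue-cong : ∀ {f g} → f ≈ g → residue f ≈ residue g
    residue-cong p = at (respects p 1ᴸ) -1ℤ

    private
      d/du-1 : d/du 1ᴸ ≈ᴸ L.ε
      at d/du-1 +0           = zeroʳ _
      at d/du-1 +[1+ _ ]     = zeroʳ _
      at d/du-1 -[1+ zero ]  = zeroˡ _
      at d/du-1 -[1+ suc _ ] = zeroʳ _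

      ∂ᴸ-1 : ∀ i → ∂ᴸ i 1ᴸ ≈ᴸ L.ε
      at (∂ᴸ-1 i) +0       = refl
      at (∂ᴸ-1 i) +[1+ _ ] = refl
      at (∂ᴸ-1 i) -[1+ _ ] = refl

      ∇-1 : ∀ i → ∇ i 1ᴸ ≈ᴸ L.ε
      at (∇-1 i) k = trans (+-cong (at (∂ᴸ-1 i) k)
        (trans (-‿cong (trans (*-congˡ (at d/du-1 k)) (zeroʳ _))) -0#≈0#)) (+-identityˡ _)

      -- When `D` kills 1, its Leibniz rule at 1 says that the expansion of the derivative is `D` of
      -- the expansion.
      leibniz-at-1 : (D : Laurent ℓ → Laurent ℓ) (f f′ : 𝒪 (suc ℓ)) →
                     D (⟦ f ⟧ 1ᴸ) ≈ᴸ ⟦ f ⟧ (D 1ᴸ) +ᴸ ⟦ f′ ⟧ 1ᴸ →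
                     D 1ᴸ ≈ᴸ L.ε → residue f′ ≈ coeff (D (⟦ f ⟧ 1ᴸ)) -1ℤ
      leibniz-at-1 D f f′ p D1≈0 = sym (at (L.trans p (L.trans
        (L.∙-congʳ {⟦ f′ ⟧ 1ᴸ} (L.trans (F.cong D1≈0) F.0-homo)) (L.identityˡ (⟦ f′ ⟧ 1ᴸ)))) -1ℤ)
        where module F = IsAdditive (additive f)

    -- The coefficient of `u⁻¹` in a derivative by `u` carries the factor `-1 + 1 = 0`.
    residue-∂x : ∀ f → residue (∂ zero f) ≈ con 0ℚ
    residue-∂x f = trans
      (leibniz-at-1 d/du f (∂ zero f) (leibniz d/du-additive zero d/du-con d/du-var f 1ᴸ) d/du-1)
      (zeroˡ _)

    -- The correction term of `∇ i` is a constant times a derivative by `u`, so it has no residue.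
    residue-∂ : ∀ i f → residue (∂ (suc i) f) ≈ ∂ i (residue f)
    residue-∂ i f = trans
      (leibniz-at-1 (∇ i) f (∂ (suc i) f) (leibniz (∇-additive i) (suc i) (∇-con i) (∇-var i) f 1ᴸ) (∇-1 i))
      (trans (+-congˡ (-‿cong (trans (*-congˡ {x = ∂coord i a} (zeroˡ (coeff (⟦ f ⟧ 1ᴸ) +0))) (zeroʳ _))))
             (trans (+-congˡ -0#≈0#) (+-identityʳ _)))

    private
      lifted-liftᵃ : ∀ (b : AffinePoint ℓ) → lifted (liftᵃ b) ≡ old b
      lifted-liftᵃ 𝟎     = ≡.refl
      lifted-liftᵃ 𝟏     = ≡.refl
      lifted-liftᵃ (t _) = ≡.refl

      pole-1 : ∀ b → coeff (pole b 1ᴸ) -1ℤ ≈ con (δ a b)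
      pole-1 b with a ≟ᵃ b
      ... | yes _ = refl
      -- The bound of `1ᴸ` is -1, so this coefficient has relative index 0, where `quotient` is 0.
      ... | no  _ = refl

    ⟦ι⟧ : ∀ f m → ⟦ ι f ⟧ m ≈ᴸ scale f m
    ⟦ι⟧ (con q) m = L.refl
    ⟦ι⟧ (var i) m = L.refl
    ⟦ι⟧ (f + g) m = L.trans (L.∙-cong (⟦ι⟧ f m) (⟦ι⟧ g m)) (coeffwise λ _ → sym (distribʳ _ _ _))
    ⟦ι⟧ (f * g) m = L.trans (⟦ι⟧ f (⟦ ι g ⟧ m))
      (L.trans (IsAdditive.cong (scale-additive f) (⟦ι⟧ g m)) (coeffwise λ _ → sym (*-assoc _ _ _)))
    ⟦ι⟧ (- f)   m = L.trans (L.⁻¹-cong (⟦ι⟧ f m))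
      (coeffwise λ k → solve 2 (λ f s → (:- (f :* s)) := ((:- f) :* s)) refl f (coeff m k))
    ⟦ι⟧ (1/[ b - c ] b≢c) m rewrite lifted-liftᵃ b | lifted-liftᵃ c = L.refl

    residue-pole : ∀ f b → residue (ι f * e b) ≈ con (δ a b) * f
    residue-pole f b rewrite lifted-liftᵃ b =
      trans (at (⟦ι⟧ f (pole b 1ᴸ)) -1ℤ) (trans (*-congˡ (pole-1 b)) (*-comm _ _))

-- Exact forms of top degree

fromℕ : ℕ → ℚ
fromℕ n = fromℤ (pos n)

fromℕ-nonNegative : ∀ n → ℚ.NonNegative (fromℕ n)
fromℕ-nonNegative zero    = _
fromℕ-nonNegative (suc n) = ℚ.nonNeg+nonNeg⇒nonNeg (fromℕ n) {{fromℕ-nonNegative n}} 1ℚ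

fromℕ-positive : ∀ n → ℚ.Positive (fromℕ (suc n))
fromℕ-positive n = ℚ.nonNeg+pos⇒pos (fromℕ n) {{fromℕ-nonNegative n}} 1ℚ

sign : ℕ → ℚ
sign zero    = 1ℚ
sign (suc n) = ℚ.- sign n

-- The f for which the form f dt₁ ⋯ dt_ℓ is exact.
data Null {ℓ : ℕ} : 𝒪 ℓ → Set where
  ∂-null : ∀ i g → Null (∂ i g)
  0-null : Null (con 0ℚ)
  +-null : ∀ {f g} → Null f → Null g → Null (f + g)
  resp   : ∀ {f g} → f ≈ g → Null f → Null g

module _ {ℓ : ℕ} where
  open 𝒪-Ring {ℓ}
  open ≈-Reasoning

  ∂-con* : ∀ i q (g : 𝒪 ℓ) → ∂ i (con q * g) ≈ con q * ∂ i g
  ∂-con* i q g = trans (+-cong (zeroˡ g) refl) (+-identityˡ _)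

  con*-null : ∀ q {f : 𝒪 ℓ} → Null f → Null (con q * f)
  con*-null q (∂-null i g) = resp (∂-con* i q g) (∂-null i (con q * g))
  con*-null q 0-null       = resp (sym (zeroʳ _)) 0-null
  con*-null q (+-null m n) = resp (sym (distribˡ _ _ _)) (+-null (con*-null q m) (con*-null q n))
  con*-null q (resp p n)   = resp (*-congˡ p) (con*-null q n)

  -‿null : {f : 𝒪 ℓ} → Null f → Null (- f)
  -‿null n = resp (trans (*-congʳ (con-‿- 1ℚ)) (-1*x≈-x _)) (con*-null (ℚ.- 1ℚ) n)

  sum-null : ∀ {n} (f : Vector (𝒪 ℓ) n) → (∀ i → Null (f i)) → Null (sum f)
  sum-null {zero}  f p = 0-null
  sum-null {suc n} f p = +-null (p zero) (sum-null (f ∘ suc) (p ∘ suc))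

  sum-0 : ∀ {n} (f : Vector (𝒪 ℓ) n) → (∀ i → f i ≈ con 0ℚ) → sum f ≈ con 0ℚ
  sum-0 {zero}  f p = refl
  sum-0 {suc n} f p = trans (+-cong (p zero) (sum-0 (f ∘ suc) (p ∘ suc))) (+-identityˡ _)

  sum-single : ∀ {n} (f : Vector (𝒪 ℓ) n) i → (∀ j → j ≢ i → f j ≈ con 0ℚ) → sum f ≈ f i
  sum-single {suc n} f zero    p = trans (+-congˡ (sum-0 (f ∘ suc) (λ j → p (suc j) λ ()))) (+-identityʳ _)
  sum-single {suc n} f (suc i) p = trans
    (+-cong (p zero λ ()) (sum-single (f ∘ suc) i (λ j j≢i → p (suc j) (j≢i ∘ Fin.suc-injective))))
    (+-identityˡ _)

  sign-^ : ∀ n → (- con 1ℚ) ^ n ≈ con (sign n)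
  sign-^ zero    = refl
  sign-^ (suc n) = trans (-1*x≈-x _) (trans (-‿cong (sign-^ n)) (sym (con-‿- (sign n))))

  sign² : ∀ n → (- con 1ℚ) ^ n * con (sign n) ≈ con 1ℚ
  sign² zero    = *-identityˡ _
  sign² (suc n) = trans (*-cong (-1*x≈-x _) (con-‿- (sign n)))
    (trans (solve 2 (λ s q → ((:- s) :* (:- q)) := (s :* q)) refl ((- con 1ℚ) ^ n) (con (sign n))) (sign² n))

full : ∀ ℓ → MultiIndex ℓ ℓ
full zero    = []
full (suc ℓ) = keep (full ℓ)

full-unique : (I : MultiIndex ℓ ℓ) → I ≡ full ℓ
full-unique []       = ≡.refl
full-unique (skip I) = ⊥-elim (1+n≰n (multiIndex-≤ I))
full-unique (keep I) = ≡.cong keep (full-unique I)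

lookup-full : ∀ (p : Fin ℓ) → lookup (full ℓ) p ≡ p
lookup-full zero    = ≡.refl
lookup-full (suc p) = ≡.cong suc (lookup-full p)

-- A sequence of length `k` in `Fin (suc k)` is known by the index it skips; this labels the
-- components of a form one degree below the top.
missing : MultiIndex k (suc k) → Fin (suc k)
missing (skip _)         = zero
missing {suc k} (keep I) = suc (missing I)

missing-omit : ∀ (p : Fin (suc k)) → missing (omit (full (suc k)) p) ≡ p
missing-omit zero            = ≡.refl
missing-omit {suc k} (suc p) = ≡.cong suc (missing-omit p)

exact⇒null : (ω : Ω ℓ ℓ) → Exact ω → Null (ω (full ℓ))
exact⇒null {zero}  ω p       = resp (sym (p [])) 0-null
exact⇒null {suc ℓ} ω (η , p) = resp (sym (p I)) (sum-null _ λ j →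
  resp (*-congʳ (sym (sign-^ (toℕ j)))) (con*-null (sign (toℕ j)) (∂-null (lookup I j) (η (omit I j)))))
  where
  open 𝒪-Ring
  I = full (suc ℓ)

null⇒exact : {f : 𝒪 ℓ} → Null f → Exact {ℓ} {ℓ} (λ _ → f)
null⇒exact 0-null       = exact-0 {ω = 0Ω} λ _ → refl
null⇒exact (+-null m n) = exact-+ (null⇒exact m) (null⇒exact n)
null⇒exact (resp p n)   = exact-cong (λ _ → p) (null⇒exact n)
null⇒exact {suc ℓ} (∂-null i g) = η , λ I → sym (≡.subst (λ I → d η I ≈ ∂ i g) (≡.sym (full-unique I)) dη)
  where
  open 𝒪-Ring
  -- The primitive has one component, `g` times the product of all `dtⱼ` with `j ≠ i`; its sign
  -- undoes the one that `d` introduces when `dtᵢ` moves into place.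
  component : Fin (suc ℓ) → 𝒪 (suc ℓ)
  component j with j Fin.≟ i
  ... | yes _ = con (sign (toℕ i)) * g
  ... | no  _ = con 0ℚ
  η : Ω (suc ℓ) ℓ
  η J = component (missing J)
  term : Fin (suc ℓ) → 𝒪 (suc ℓ)
  term j = (- con 1ℚ) ^ toℕ j * ∂ j (component j)
  term-≢ : ∀ j → j ≢ i → term j ≈ con 0ℚ
  term-≢ j j≢i with j Fin.≟ i
  ... | yes j≡i = ⊥-elim (j≢i j≡i)
  ... | no  _   = zeroʳ ((- con 1ℚ) ^ toℕ j)
  term-i : term i ≈ ∂ i g
  term-i with i Fin.≟ i
  ... | no i≢i = ⊥-elim (i≢i ≡.refl)
  ... | yes _  = trans (*-congˡ {x = (- con 1ℚ) ^ toℕ i} (∂-con* i (sign (toℕ i)) g))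
    (trans (sym (*-assoc _ _ _)) (trans (*-congʳ (sign² (toℕ i))) (*-identityˡ (∂ i g))))
  dη : d η (full (suc ℓ)) ≈ ∂ i g
  dη = trans (sum-cong-≋ λ p → reflexive (≡.cong₂ (λ l J → (- con 1ℚ) ^ toℕ p * ∂ l (component J))
                                            (lookup-full p) (missing-omit p)))
       (trans (sum-single term i term-≢) term-i)

ι-∂ : ∀ i (f : 𝒪 ℓ) → ∂ (suc i) (ι f) ≡ ι (∂ i f)
ι-∂ i (con q) = ≡.refl
ι-∂ i (var j) = ≡.refl
ι-∂ i (f + g) = ≡.cong₂ _+_ (ι-∂ i f) (ι-∂ i g)
ι-∂ i (f * g) = ≡.cong₂ (λ f′ g′ → f′ * ι g + ι f * g′) (ι-∂ i f) (ι-∂ i g)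
ι-∂ i (- f)   = ≡.cong -_ (ι-∂ i f)
ι-∂ i (1/[ a - b ] a≢b) =
  ≡.cong₂ (λ a′ b′ → - (u * u * (a′ + - b′))) (∂-lift a) (∂-lift b)
  where
  u = ι (1/[ a - b ] a≢b)
  ∂-lift : ∀ a → ∂coord (suc i) (liftᵃ a) ≡ ι (∂coord i a)
  ∂-lift 𝟎     = ≡.refl
  ∂-lift 𝟏     = ≡.refl
  ∂-lift (t _) = ≡.refl

∂coord-lift : ∀ (a : AffinePoint ℓ) → ∂coord zero (liftᵃ a) ≡ con 0ℚ
∂coord-lift 𝟎     = ≡.refl
∂coord-lift 𝟏     = ≡.refl
∂coord-lift (t _) = ≡.refl

∂coord-constant : ∀ i (a : AffinePoint ℓ) → ∃ λ q → ∂coord i a ≡ con q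
∂coord-constant i 𝟎     = _ , ≡.refl
∂coord-constant i 𝟏     = _ , ≡.refl
∂coord-constant i (t _) = _ , ≡.refl

module _ {ℓ : ℕ} where
  open 𝒪-Ring {suc ℓ}
  open ≈-Reasoning

  ∂x-ι : ∀ f → ∂ zero (ι {ℓ} f) ≈ con 0ℚ
  ∂x-ι (con q) = refl
  ∂x-ι (var j) = refl
  ∂x-ι (f + g) = trans (+-cong (∂x-ι f) (∂x-ι g)) (+-identityˡ _)
  ∂x-ι (f * g) = trans (+-cong (trans (*-congʳ (∂x-ι f)) (zeroˡ _)) (trans (*-congˡ (∂x-ι g)) (zeroʳ _)))
                       (+-identityˡ _)
  ∂x-ι (- f)   = trans (-‿cong (∂x-ι f)) -0#≈0#
  ∂x-ι (1/[ a - b ] a≢b) rewrite ∂coord-lift a | ∂coord-lift b =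
    trans (-‿cong (trans (*-congˡ (-‿inverseʳ _)) (zeroʳ _))) -0#≈0#

  ∂x-ι* : ∀ c f → ∂ zero (ι c * f) ≈ ι c * ∂ zero f
  ∂x-ι* c f = trans (+-cong (trans (*-congʳ (∂x-ι c)) (zeroˡ _)) refl) (+-identityˡ _)

  ∂-^ : ∀ i f n → ∂ i (f ^ suc n) ≈ con (fromℕ (suc n)) * (f ^ n * ∂ i f)
  ∂-^ i f zero = begin
    ∂ i f * con 1ℚ + f * con 0ℚ  ≈⟨ +-cong (*-comm _ _) (zeroʳ f) ⟩
    con 1ℚ * ∂ i f + con 0ℚ      ≈⟨ +-identityʳ _ ⟩
    con 1ℚ * ∂ i f               ≈⟨ *-identityˡ _ ⟨
    con 1ℚ * (con 1ℚ * ∂ i f)    ∎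
  ∂-^ i f (suc n) = begin
    ∂ i f * f ^ suc n + f * ∂ i (f ^ suc n)
      ≈⟨ +-cong (sym (*-identityˡ _)) (*-congˡ (∂-^ i f n)) ⟩
    con 1ℚ * (∂ i f * (f * f ^ n)) + f * (con (fromℕ (suc n)) * (f ^ n * ∂ i f))
      ≈⟨ solve 5 (λ e q f p f′ → (e :* (f′ :* (f :* p)) :+ f :* (q :* (p :* f′)))
                             := ((q :+ e) :* ((f :* p) :* f′))) refl
           (con 1ℚ) (con (fromℕ (suc n))) f (f ^ n) (∂ i f) ⟩
    (con (fromℕ (suc n)) + con 1ℚ) * (f ^ suc n * ∂ i f)
      ≈⟨ *-congʳ (con-+ _ 1ℚ) ⟨
    con (fromℕ (suc (suc n))) * (f ^ suc n * ∂ i f) ∎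

  -- The primitive is `c fⁿ⁺¹ / (n + 1)`, with `c` constant in `x`. Dividing by `n + 1` uses
  -- characteristic zero.
  power-null : ∀ c f n → Null (ι c * (f ^ n * ∂ zero f))
  power-null c f n = resp (begin
    con q * ∂ zero (ι c * f ^ suc n)
      ≈⟨ *-congˡ (trans (∂x-ι* c (f ^ suc n)) (*-congˡ (∂-^ zero f n))) ⟩
    con q * (ι c * (con p * (f ^ n * ∂ zero f)))
      ≈⟨ solve 4 (λ q c p g → (q :* (c :* (p :* g))) := ((q :* p) :* (c :* g))) refl
           (con q) (ι c) (con p) (f ^ n * ∂ zero f) ⟩
    con q * con p * (ι c * (f ^ n * ∂ zero f))
      ≈⟨ *-congʳ (trans (sym (con-* q p)) (reflexive (≡.cong con (ℚ.*-inverseˡ p)))) ⟩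
    con 1ℚ * (ι c * (f ^ n * ∂ zero f))
      ≈⟨ *-identityˡ _ ⟩
    ι c * (f ^ n * ∂ zero f) ∎) (con*-null q (∂-null zero (ι c * f ^ suc n)))
    where
    p = fromℕ (suc n)
    instance
      p-nonZero : ℚ.NonZero p
      p-nonZero = ℚ.pos⇒nonZero p {{fromℕ-positive n}}
    q = ℚ.1/ p

  x-power-null : ∀ c n → Null (ι c * var zero ^ n)
  x-power-null c n = resp (*-congˡ {x = ι c} (*-identityʳ _)) (power-null c (var zero) n)

  ∂x-e : ∀ a → ∂ zero (e a) ≈ - (e a * e a)
  ∂x-e a rewrite ∂coord-lift a =
    -‿cong (trans (*-congˡ (trans (+-congˡ -0#≈0#) (+-identityʳ _))) (*-identityʳ _))

  -- This is `power-null` for `f = e a`, whose derivative is `- e a ^ 2`. Simple poles escape, as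
  -- they would require `n = -1`.
  e-power-null : ∀ c a n → Null (ι c * e a ^ suc (suc n))
  e-power-null c a n = resp (begin
    - (ι c * (e a ^ n * ∂ zero (e a)))
      ≈⟨ -‿cong (*-congˡ {x = ι c} (*-congˡ {x = e a ^ n} (∂x-e a))) ⟩
    - (ι c * (e a ^ n * - (e a * e a)))
      ≈⟨ solve 3 (λ c e p → (:- (c :* (p :* :- (e :* e)))) := (c :* (e :* (e :* p)))) refl (ι c) (e a) (e a ^ n) ⟩
    ι c * e a ^ suc (suc n) ∎) (-‿null (power-null c (e a) n))

  -- The counterpart of `residue-null`: a class on the smaller space can be placed at the pole `a`.
  -- By the product rule `(∂ᵢg)/(x - a)` is `∂ᵢ(g/(x - a))` minus `∂ᵢa · g/(x - a)²`; the latter is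
  -- a double pole with the rational factor `q = ∂ᵢa`, hence null.
  ι*e-null : ∀ {f} a → Null f → Null (ι f * e a)
  ι*e-null a 0-null       = resp (sym (zeroˡ _)) 0-null
  ι*e-null a (+-null m n) = resp (sym (distribʳ _ _ _)) (+-null (ι*e-null a m) (ι*e-null a n))
  ι*e-null a (resp p n)   = resp (*-congʳ (ι-cong p)) (ι*e-null a n)
  ι*e-null a (∂-null i g) with ∂coord (suc i) (liftᵃ a) in eq | ∂coord-constant (suc i) (liftᵃ a)
  ... | ._ | q , ≡.refl = resp (begin
    ∂ (suc i) (ι g * e a) + con (ℚ.- q) * (ι g * e a ^ 2)
      ≡⟨ ≡.cong (λ a′ → (∂ (suc i) (ι g) * e a + ι g * - (e a * e a * (con 0ℚ + - a′))) + con (ℚ.- q) * (ι g * e a ^ 2)) eq ⟩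
    (∂ (suc i) (ι g) * e a + ι g * - (e a * e a * (con 0ℚ + - con q))) + con (ℚ.- q) * (ι g * (e a * (e a * con 1ℚ)))
      ≈⟨ +-cong (+-congˡ (*-congˡ {x = ι g} (-‿cong (*-congˡ (+-identityˡ (- con q))))))
                (*-cong (con-‿- q) (*-congˡ {x = ι g} (*-congˡ (*-identityʳ (e a))))) ⟩
    (∂ (suc i) (ι g) * e a + ι g * - (e a * e a * (- con q))) + - con q * (ι g * (e a * e a))
      ≈⟨ solve 4 (λ h g e q → ((h :* e :+ g :* :- (e :* e :* (:- q))) :+ (:- q) :* (g :* (e :* e))) := (h :* e)) refl
           (∂ (suc i) (ι g)) (ι g) (e a) (con q) ⟩
    ∂ (suc i) (ι g) * e a
      ≡⟨ ≡.cong (_* e a) (ι-∂ i g) ⟩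
    ι (∂ i g) * e a ∎)
    (+-null (∂-null (suc i) (ι g * e a)) (con*-null (ℚ.- q) (e-power-null g a 0)))

-- Partial fractions in `x`

module _ {ℓ : ℕ} where
  open 𝒪-Ring {ℓ}
  open ≈-Reasoning

  1/-swap : ∀ (a b : AffinePoint ℓ) .(a≢b : a ≢ b) → 1/[ a - b ] a≢b ≈ - 1/[ b - a ] (a≢b ∘ ≡.sym)
  1/-swap a b a≢b = begin
    u                                     ≈⟨ *-identityʳ u ⟨
    u * con 1ℚ                            ≈⟨ *-congˡ (1/-inverseˡ b a _) ⟨
    u * (w * (coord b + - coord a))
      ≈⟨ solve 4 (λ u w a b → (u :* (w :* (b :+ :- a))) := (:- (w :* (u :* (a :+ :- b))))) refl u w (coord a) (coord b) ⟩
    - (w * (u * (coord a + - coord b)))   ≈⟨ -‿cong (*-congˡ (1/-inverseˡ a b a≢b)) ⟩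
    - (w * con 1ℚ)                        ≈⟨ -‿cong (*-identityʳ w) ⟩
    - w                                   ∎
    where
    u = 1/[ a - b ] a≢b
    w = 1/[ b - a ] (a≢b ∘ ≡.sym)

  1/[1-0] : .(1≢0 : 𝟏 {ℓ} ≢ 𝟎) → 1/[ 𝟏 - 𝟎 ] 1≢0 ≈ con 1ℚ
  1/[1-0] 1≢0 = begin
    1/[ 𝟏 - 𝟎 ] _                          ≈⟨ *-identityʳ _ ⟨
    1/[ 𝟏 - 𝟎 ] _ * con 1ℚ                 ≈⟨ *-congˡ (trans (+-congˡ -0#≈0#) (+-identityʳ _)) ⟨
    1/[ 𝟏 - 𝟎 ] _ * (con 1ℚ + - con 0ℚ)    ≈⟨ 1/-inverseˡ 𝟏 𝟎 1≢0 ⟩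
    con 1ℚ ∎

module _ {ℓ : ℕ} where
  open 𝒪-Ring {suc ℓ}
  open ≈-Reasoning

  e-inverse : ∀ a → e {ℓ} a * (var zero + - ι (coord a)) ≈ con 1ℚ
  e-inverse a rewrite ι-coord a = 1/-inverseˡ x (liftᵃ a) liftᵃ≢x

  x*e : ∀ a → var zero * e {ℓ} a ≈ con 1ℚ + ι (coord a) * e a
  x*e a = begin
    var zero * e a
      ≈⟨ solve 3 (λ x a e → (x :* e) := (e :* (x :+ :- a) :+ a :* e)) refl (var zero) (ι (coord a)) (e a) ⟩
    e a * (var zero + - ι (coord a)) + ι (coord a) * e a
      ≈⟨ +-cong (e-inverse a) refl ⟩
    con 1ℚ + ι (coord a) * e a ∎

  -- Write `b - a` as `(x - a) - (x - b)`; each difference cancels one of the two poles.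
  e*e : ∀ {a b} .(b≢a : b ≢ a) → e {ℓ} b * e a ≈ ι (1/[ b - a ] b≢a) * (e b + - e a)
  e*e {a} {b} b≢a = begin
    e b * e a
      ≈⟨ *-identityˡ _ ⟨
    con 1ℚ * (e b * e a)
      ≈⟨ *-congʳ (ι-cong (1/-inverseˡ b a b≢a)) ⟨
    v * (ι (coord b) + - ι (coord a)) * (e b * e a)
      ≈⟨ solve 6 (λ v a b x u w → (v :* (b :+ :- a) :* (u :* w))
                   := (v :* (u :* (w :* (x :+ :- a)) :+ :- (w :* (u :* (x :+ :- b))))))
           refl v (ι (coord a)) (ι (coord b)) (var zero) (e b) (e a) ⟩
    v * (e b * (e a * (var zero + - ι (coord a))) + - (e a * (e b * (var zero + - ι (coord b)))))
      ≈⟨ *-congˡ (+-cong (trans (*-congˡ (e-inverse a)) (*-identityʳ _))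
                         (-‿cong (trans (*-congˡ (e-inverse b)) (*-identityʳ _)))) ⟩
    v * (e b + - e a) ∎
    where v = ι (1/[ b - a ] b≢a)

  -- All functions have this form because the predicate holds for 1 and is closed
  -- under multiplication by the generators of the ring.
  data PartialFraction : 𝒪 (suc ℓ) → Set where
    x-power : ∀ c n → PartialFraction (ι c * var zero ^ n)
    e-power : ∀ c a n → PartialFraction (ι c * e a ^ n)
    plus    : ∀ {f g} → PartialFraction f → PartialFraction g → PartialFraction (f + g)
    ≈-resp  : ∀ {f g} → f ≈ g → PartialFraction f → PartialFraction g

  ι*-pf : ∀ c {f} → PartialFraction f → PartialFraction (ι c * f)
  ι*-pf c (x-power b n)   = ≈-resp (*-assoc _ _ _) (x-power (c * b) n)
  ι*-pf c (e-power b a n) = ≈-resp (*-assoc _ _ _) (e-power (c * b) a n)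
  ι*-pf c (plus p q)      = ≈-resp (sym (distribˡ _ _ _)) (plus (ι*-pf c p) (ι*-pf c q))
  ι*-pf c (≈-resp eq p)   = ≈-resp (*-congˡ eq) (ι*-pf c p)

  neg-pf : ∀ {f} → PartialFraction f → PartialFraction (- f)
  neg-pf p = ≈-resp (-1*x≈-x _) (ι*-pf (- con 1ℚ) p)

  x*-pf : ∀ {f} → PartialFraction f → PartialFraction (var zero * f)
  x*-pf (x-power c n) =
    ≈-resp (solve 3 (λ c x p → (c :* (x :* p)) := (x :* (c :* p))) refl (ι c) (var zero) (var zero ^ n))
      (x-power c (suc n))
  x*-pf (e-power c a zero)    =
    ≈-resp (solve 3 (λ c x p → (c :* (x :* p)) := (x :* (c :* p))) refl (ι c) (var zero) (con 1ℚ)) (x-power c 1)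
  x*-pf (e-power c a (suc n)) = ≈-resp (begin
    ι c * e a ^ n + ι (coord a) * (ι c * e a ^ suc n)
      ≈⟨ +-cong (sym (*-identityˡ _)) refl ⟩
    con 1ℚ * (ι c * e a ^ n) + ι (coord a) * (ι c * e a ^ suc n)
      ≈⟨ solve 5 (λ o a c e p → (o :* (c :* p) :+ a :* (c :* (e :* p))) := ((o :+ a :* e) :* (c :* p))) refl
           (con 1ℚ) (ι (coord a)) (ι c) (e a) (e a ^ n) ⟩
    (con 1ℚ + ι (coord a) * e a) * (ι c * e a ^ n)
      ≈⟨ *-congʳ (x*e a) ⟨
    var zero * e a * (ι c * e a ^ n)
      ≈⟨ solve 4 (λ x c e p → (x :* e :* (c :* p)) := (x :* (c :* (e :* p)))) refl (var zero) (ι c) (e a) (e a ^ n) ⟩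
    var zero * (ι c * e a ^ suc n) ∎)
    (plus (e-power c a n) (ι*-pf (coord a) (e-power c a (suc n))))
  x*-pf (plus p q)    = ≈-resp (sym (distribˡ _ _ _)) (plus (x*-pf p) (x*-pf q))
  x*-pf (≈-resp eq p) = ≈-resp (*-congˡ eq) (x*-pf p)

  -- For `b ≠ a`, `e*e` splits off one factor `e a`: one summand has a lower power of `e a` and is
  -- left to the recursion, the other has lost `e b` and is already of the required form.
  e*-e-power : ∀ b c a n → PartialFraction (e b * (ι c * e a ^ n))
  e*-e-power b c a zero =
    ≈-resp (solve 3 (λ c x p → (c :* (x :* p)) := (x :* (c :* p))) refl (ι c) (e b) (con 1ℚ)) (e-power c b 1)
  e*-e-power b c a (suc n) with b ≟ᵃ a
  ... | yes ≡.refl =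
    ≈-resp (solve 3 (λ c x p → (c :* (x :* p)) := (x :* (c :* p))) refl (ι c) (e b) (e b ^ suc n))
      (e-power c b (suc (suc n)))
  ... | no b≢a = ≈-resp (begin
    v * (e b * (ι c * e a ^ n)) + - (v * (ι c * e a ^ suc n))
      ≈⟨ solve 5 (λ v u c w p → (v :* (u :* (c :* p)) :+ :- (v :* (c :* (w :* p))))
                             := ((v :* (u :+ :- w)) :* (c :* p))) refl v (e b) (ι c) (e a) (e a ^ n) ⟩
    v * (e b + - e a) * (ι c * e a ^ n)
      ≈⟨ *-congʳ (e*e b≢a) ⟨
    e b * e a * (ι c * e a ^ n)
      ≈⟨ solve 4 (λ u c w p → (u :* w :* (c :* p)) := (u :* (c :* (w :* p)))) refl (e b) (ι c) (e a) (e a ^ n) ⟩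
    e b * (ι c * e a ^ suc n) ∎)
    (plus (ι*-pf (1/[ b - a ] b≢a) (e*-e-power b c a n))
          (neg-pf (ι*-pf (1/[ b - a ] b≢a) (e-power c a (suc n)))))
    where v = ι (1/[ b - a ] b≢a)

  e*-pf : ∀ b {f} → PartialFraction f → PartialFraction (e b * f)
  e*-pf b (x-power c zero) =
    ≈-resp (solve 3 (λ c x p → (c :* (x :* p)) := (x :* (c :* p))) refl (ι c) (e b) (con 1ℚ)) (e-power c b 1)
  -- Since `x/(x - b) = 1 + b/(x - b)`, each summand has one power of `x` less.
  e*-pf b (x-power c (suc n)) = ≈-resp (begin
    ι c * var zero ^ n + ι (coord b) * (e b * (ι c * var zero ^ n))
      ≈⟨ +-cong (sym (*-identityˡ _)) refl ⟩
    con 1ℚ * (ι c * var zero ^ n) + ι (coord b) * (e b * (ι c * var zero ^ n))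
      ≈⟨ solve 5 (λ o b c e p → (o :* (c :* p) :+ b :* (e :* (c :* p))) := ((o :+ b :* e) :* (c :* p))) refl
           (con 1ℚ) (ι (coord b)) (ι c) (e b) (var zero ^ n) ⟩
    (con 1ℚ + ι (coord b) * e b) * (ι c * var zero ^ n)
      ≈⟨ *-congʳ (x*e b) ⟨
    var zero * e b * (ι c * var zero ^ n)
      ≈⟨ solve 4 (λ x c e p → (x :* e :* (c :* p)) := (e :* (c :* (x :* p)))) refl (var zero) (ι c) (e b) (var zero ^ n) ⟩
    e b * (ι c * var zero ^ suc n) ∎)
    (plus (x-power c n) (ι*-pf (coord b) (e*-pf b (x-power c n))))
  e*-pf b (e-power c a n) = e*-e-power b c a n
  e*-pf b (plus p q)    = ≈-resp (sym (distribˡ _ _ _)) (plus (e*-pf b p) (e*-pf b q))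
  e*-pf b (≈-resp eq p) = ≈-resp (*-congˡ eq) (e*-pf b p)

  *-pf : ∀ f {g} → PartialFraction g → PartialFraction (f * g)
  *-pf (con q)       p = ι*-pf (con q) p
  *-pf (var zero)    p = x*-pf p
  *-pf (var (suc i)) p = ι*-pf (var i) p
  *-pf (f + g)       p = ≈-resp (sym (distribʳ _ _ _)) (plus (*-pf f p) (*-pf g p))
  *-pf (f * g)       p = ≈-resp (sym (*-assoc _ _ _)) (*-pf f (*-pf g p))
  *-pf (- f) {g}     p = ≈-resp (solve 2 (λ f g → (:- (f :* g)) := ((:- f) :* g)) refl f g) (neg-pf (*-pf f p))
  *-pf (1/[ a - b ] a≢b) p = go (lifted a) (lifted b) a≢b p
    where
    go : ∀ {a b} → Lifted a → Lifted b → .(a≢b : a ≢ b) → ∀ {g} →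
         PartialFraction g → PartialFraction (1/[ a - b ] a≢b * g)
    go new     new     x≢x p = ⊥-elim-irr (x≢x ≡.refl)
    go new     (old b) _   p = e*-pf b p
    go (old a) new     a≢x {g} p = ≈-resp
      (trans (solve 2 (λ f g → (:- (f :* g)) := ((:- f) :* g)) refl (e a) g)
             (*-congʳ (sym (1/-swap (liftᵃ a) x a≢x))))
      (neg-pf (e*-pf a p))
    go (old a) (old b) a≢b p = ι*-pf (1/[ a - b ] (a≢b ∘ ≡.cong liftᵃ)) p

  partialFraction : ∀ f → PartialFraction f
  partialFraction f = ≈-resp (trans (*-congˡ {x = f} (*-identityˡ _)) (*-identityʳ f)) (*-pf f (x-power (con 1ℚ) 0))

  -- Modulo exact forms only the simple poles in x survive.
  simple-poles : (P : 𝒪 (suc ℓ) → Set) → (∀ {f g} → f ≈ g → P f → P g) →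
                 (∀ {f g} → P f → P g → P (f + g)) → (∀ {f} → Null f → P f) →
                 (∀ c a → P (ι c * e a)) → ∀ f → P f
  simple-poles P P-resp P-+ P-null P-e f = go (partialFraction f)
    where
    go : ∀ {f} → PartialFraction f → P f
    go (x-power c n)             = P-null (x-power-null c n)
    go (e-power c a zero)        = P-null (x-power-null c 0)
    go (e-power c a (suc zero))  = P-resp (*-congˡ {x = ι c} (sym (*-identityʳ _))) (P-e c a)
    go (e-power c a (suc (suc n))) = P-null (e-power-null c a n)
    go (plus p q)                = P-+ (go p) (go q)
    go (≈-resp eq p)             = P-resp eq (go p)

-- Cell-functions as products along paths

-- 1/(a - b), with the junk value 0 if a = b
1/ : (a b : AffinePoint ℓ) → 𝒪 ℓ
1/ a b with a ≟ᵃ b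
... | yes _  = con 0ℚ
... | no a≢b = 1/[ a - b ] a≢b

1/-≢ : ∀ {a b : AffinePoint ℓ} (a≢b : a ≢ b) → 1/ a b ≡ 1/[ a - b ] a≢b
1/-≢ {a = a} {b} a≢b with a ≟ᵃ b
... | yes a≡b = ⊥-elim (a≢b a≡b)
... | no _    = ≡.refl

edge : Point ℓ → Point ℓ → 𝒪 ℓ
edge (affine a) (affine b) = 1/ b a
edge _          _          = con 1ℚ

-- Cutting the cyclic ordering (0, 1, π) between 0 and 1 gives a path
-- 1, π, 0; deleting the factors at ∞ leaves the factors of the cell-form.
path : Point ℓ → Vec (Point ℓ) m → 𝒪 ℓ
path p []      = edge p (affine 𝟎)
path p (q ∷ π) = edge p q * path q π

-- Edges are numbered so that `insertAt` at position `g` subdivides edge `g`; the last edge ends in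
-- 0.
source target : Point ℓ → Vec (Point ℓ) m → Fin (suc m) → Point ℓ
source p π       zero    = p
source p (q ∷ π) (suc g) = source q π g
target p []      zero    = affine 𝟎
target p (q ∷ π) zero    = q
target p (q ∷ π) (suc g) = target q π g

vertices : Point ℓ → Vec (Point ℓ) m → List (Point ℓ)
vertices p π = p ∷ toList π ++ affine 𝟎 ∷ []

liftᵖ : Point ℓ → Point (suc ℓ)
liftᵖ (affine a) = affine (liftᵃ a)
liftᵖ ∞          = ∞

ē : Point ℓ → 𝒪 (suc ℓ)
ē (affine a) = e a
ē ∞          = con 0ℚ

module _ {ℓ : ℕ} where
  open 𝒪-Ring {suc ℓ}
  open ≈-Reasoning

  edge-lift : ∀ (p q : Point ℓ) → edge (liftᵖ p) (liftᵖ q) ≈ ι (edge p q)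
  edge-lift (affine a) (affine b) with b ≟ᵃ a
  ... | no b≢a  = reflexive (1/-≢ (b≢a ∘ liftᵃ-injective))
  ... | yes ≡.refl with liftᵃ b ≟ᵃ liftᵃ b
  ...   | yes _  = refl
  ...   | no b≢b = ⊥-elim (b≢b ≡.refl)
  edge-lift (affine _) ∞          = refl
  edge-lift ∞          (affine _) = refl
  edge-lift ∞          ∞          = refl

  path-lift : ∀ (p : Point ℓ) (π : Vec (Point ℓ) m) → path (liftᵖ p) (Vec.map liftᵖ π) ≈ ι (path p π)
  path-lift p []      = edge-lift p (affine 𝟎)
  path-lift p (q ∷ π) = *-cong (edge-lift p q) (path-lift q π)

  -- With both ends finite this is `e*e` up to signs. With one end at `∞` only one factor is
  -- present, and the convention `ē ∞ = 0` gives the same formula.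
  split-edge : ∀ (p q : Point ℓ) → p ≢ q →
               edge (liftᵖ p) (affine x) * edge (affine x) (liftᵖ q) ≈ ι (edge p q) * (ē p + - ē q)
  split-edge (affine a) (affine b) a≢b = begin
    1/ x (liftᵃ a) * 1/ (liftᵃ b) x
      ≈⟨ *-cong (reflexive (1/-≢ liftᵃ≢x))
           (trans (reflexive (1/-≢ (liftᵃ≢x ∘ ≡.sym))) (1/-swap (liftᵃ b) x (liftᵃ≢x ∘ ≡.sym))) ⟩
    e a * - e b
      ≈⟨ solve 2 (λ u w → (u :* :- w) := (:- (w :* u))) refl (e a) (e b) ⟩
    - (e b * e a)
      ≈⟨ -‿cong (e*e b≢a) ⟩
    - (ι (1/[ b - a ] b≢a) * (e b + - e a))
      ≈⟨ solve 3 (λ v u w → (:- (v :* (w :+ :- u))) := (v :* (u :+ :- w))) refl (ι (1/[ b - a ] b≢a)) (e a) (e b) ⟩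
    ι (1/[ b - a ] b≢a) * (e a + - e b)
      ≡⟨ ≡.cong (λ f → ι f * (e a + - e b)) (1/-≢ b≢a) ⟨
    ι (1/ b a) * (e a + - e b) ∎
    where
    b≢a : b ≢ a
    b≢a b≡a = a≢b (≡.cong affine (≡.sym b≡a))
  split-edge (affine a) ∞ _ = begin
    1/ x (liftᵃ a) * con 1ℚ          ≈⟨ *-comm _ _ ⟩
    con 1ℚ * 1/ x (liftᵃ a)          ≈⟨ *-congˡ (reflexive (1/-≢ liftᵃ≢x)) ⟩
    con 1ℚ * e a                     ≈⟨ *-congˡ (+-identityʳ (e a)) ⟨
    con 1ℚ * (e a + con 0ℚ)          ≈⟨ *-congˡ (+-congˡ -0#≈0#) ⟨
    con 1ℚ * (e a + - con 0ℚ)        ∎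
  split-edge ∞ (affine b) _ = *-congˡ (begin
    1/ (liftᵃ b) x        ≡⟨ 1/-≢ (liftᵃ≢x ∘ ≡.sym) ⟩
    1/[ liftᵃ b - x ] _   ≈⟨ 1/-swap (liftᵃ b) x (liftᵃ≢x ∘ ≡.sym) ⟩
    - e b                 ≈⟨ +-identityˡ _ ⟨
    con 0ℚ + - e b        ∎)
  split-edge ∞ ∞ ∞≢∞ = ⊥-elim (∞≢∞ ≡.refl)

  path-insert : ∀ (p : Point ℓ) (π : Vec (Point ℓ) m) → Unique (vertices p π) → ∀ g →
                path (liftᵖ p) (insertAt (Vec.map liftᵖ π) g (affine x)) ≈
                ι (path p π) * (ē (source p π g) + - ē (target p π g))
  path-insert p []      ((p≢𝟎 ∷ _) ∷ _) zero = split-edge p (affine 𝟎) p≢𝟎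
  path-insert p (q ∷ π) ((p≢q ∷ _) ∷ _) zero = begin
    edge (liftᵖ p) (affine x) * (edge (affine x) (liftᵖ q) * path (liftᵖ q) (Vec.map liftᵖ π))
      ≈⟨ *-assoc _ _ _ ⟨
    edge (liftᵖ p) (affine x) * edge (affine x) (liftᵖ q) * path (liftᵖ q) (Vec.map liftᵖ π)
      ≈⟨ *-cong (split-edge p q p≢q) (path-lift q π) ⟩
    ι (edge p q) * (ē p + - ē q) * ι (path q π)
      ≈⟨ solve 3 (λ a b c → (a :* b :* c) := (a :* c :* b)) refl (ι (edge p q)) (ē p + - ē q) (ι (path q π)) ⟩
    ι (path p (q ∷ π)) * (ē p + - ē q) ∎
  path-insert p (q ∷ π) (_ ∷ u) (suc g) =
    trans (*-cong (edge-lift p q) (path-insert q π u g)) (sym (*-assoc _ _ _))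

  -- As ē ∞ = 0, telescoping along the path expresses each ē w by the
  -- differences at the edges between w and ∞.
  module _ (P : 𝒪 (suc ℓ) → Set) (P-resp : ∀ {f g} → f ≈ g → P f → P g)
           (P-+ : ∀ {f g} → P f → P g → P (f + g)) (P-‿- : ∀ {f} → P f → P (- f))
           (P-0 : P (con 0ℚ)) (h : 𝒪 (suc ℓ)) where

    private
      Edges : Point ℓ → Vec (Point ℓ) m → Set
      Edges p π = ∀ g → P (h * (ē (source p π g) + - ē (target p π g)))

      forwards : ∀ p q → P (h * (ē p + - ē q)) → P (h * ē p) → P (h * ē q)
      forwards p q d n = P-resp
        (solve 3 (λ h p q → (h :* p :+ :- (h :* (p :+ :- q))) := (h :* q)) refl h (ē p) (ē q))
        (P-+ n (P-‿- d))

      backwards : ∀ p q → P (h * (ē p + - ē q)) → P (h * ē q) → P (h * ē p)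
      backwards p q d n = P-resp
        (solve 3 (λ h p q → (h :* (p :+ :- q) :+ h :* q) := (h :* p)) refl h (ē p) (ē q))
        (P-+ d n)

      from-start : ∀ p (π : Vec (Point ℓ) m) → Edges p π → P (h * ē p) → All (λ w → P (h * ē w)) (vertices p π)
      from-start p []      d n = n ∷ forwards p (affine 𝟎) (d zero) n ∷ []
      from-start p (q ∷ π) d n = n ∷ from-start q π (d ∘ suc) (forwards p q (d zero) n)

      to-start : ∀ p (π : Vec (Point ℓ) m) → Edges p π → ∞ ∈ vertices p π → P (h * ē p)
      to-start p π       d (here ≡.refl) = P-resp (sym (zeroʳ h)) P-0
      to-start p []      d (there (here ()))
      to-start p (q ∷ π) d (there ∞∈)    = backwards p q (d zero) (to-start q π (d ∘ suc) ∞∈)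

    -- At `∞` the property is `P-0`. It is carried back to the start of the path, and from there
    -- forwards to every vertex.
    telescope : ∀ p (π : Vec (Point ℓ) m) → ∞ ∈ vertices p π →
                (∀ g → P (h * (ē (source p π g) + - ē (target p π g)))) →
                ∀ {w} → w ∈ vertices p π → P (h * ē w)
    telescope p π ∞∈ d = All.lookup (from-start p π d (to-start p π d ∞∈))

-- The boundary of a chain on a path

δ̄ : AffinePoint ℓ → Point ℓ → ℚ
δ̄ a (affine b) = δ a b
δ̄ a ∞          = 0ℚ

module ℚΣ = SemiringSum (CommutativeRing.semiring ℚ.+-*-commutativeRing)

-- The boundary, relative to `∞` and with sign source minus target, of the 1-chain with coefficients
-- `c`. Equivalently, the coefficient of `e a` in the combination of the differences along the
-- edges.
boundary : Point ℓ → Vec (Point ℓ) m → (Fin (suc m) → ℚ) → AffinePoint ℓ → ℚ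
boundary p π c a = ℚΣ.sum λ g → c g ℚ.* (δ̄ a (source p π g) ℚ.- δ̄ a (target p π g))

δ̄-≡ : ∀ (a : AffinePoint ℓ) → δ̄ a (affine a) ≡ 1ℚ
δ̄-≡ a with a ≟ᵃ a
... | yes _  = ≡.refl
... | no a≢a = ⊥-elim (a≢a ≡.refl)

δ̄-≢ : ∀ {a : AffinePoint ℓ} {p} → affine a ≢ p → δ̄ a p ≡ 0ℚ
δ̄-≢ {p = ∞} _ = ≡.refl
δ̄-≢ {a = a} {affine b} a≢b with a ≟ᵃ b
... | yes ≡.refl = ⊥-elim (a≢b ≡.refl)
... | no _       = ≡.refl

private
  outgoing : ∀ c {p q s} → p ≡ 1ℚ → q ≡ 0ℚ → s ≡ 0ℚ → c ℚ.* (p ℚ.- q) ℚ.+ s ≡ 0ℚ → c ≡ 0ℚ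
  outgoing c ≡.refl ≡.refl ≡.refl eq =
    ≡.trans (≡.sym (≡.trans (ℚ.+-identityʳ _) (ℚ.*-identityʳ c))) eq

  incoming : ∀ c {p q s} → p ≡ 0ℚ → q ≡ 1ℚ → s ≡ 0ℚ → c ℚ.* (p ℚ.- q) ℚ.+ s ≡ 0ℚ → c ≡ 0ℚ
  incoming c ≡.refl ≡.refl ≡.refl eq = ℚ.neg-injective (begin
    ℚ.- c               ≡⟨ ≡.cong ℚ.-_ (ℚ.*-identityʳ c) ⟨
    ℚ.- (c ℚ.* 1ℚ)      ≡⟨ ℚ.neg-distribʳ-* c 1ℚ ⟩
    c ℚ.* (ℚ.- 1ℚ)      ≡⟨ ℚ.+-identityʳ _ ⟨
    c ℚ.* (0ℚ ℚ.- 1ℚ) ℚ.+ 0ℚ ≡⟨ eq ⟩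
    0ℚ ∎)
    where open ≡-Reasoning

  passing : ∀ {c r s} → c ≡ 0ℚ → c ℚ.* r ℚ.+ s ≡ s
  passing {r = r} {s} ≡.refl = ≡.trans (≡.cong (ℚ._+ s) (ℚ.*-zeroˡ r)) (ℚ.+-identityˡ s)

  avoiding : ∀ c {p q s} → p ≡ 0ℚ → q ≡ 0ℚ → c ℚ.* (p ℚ.- q) ℚ.+ s ≡ s
  avoiding c {s = s} ≡.refl ≡.refl = ≡.trans (≡.cong (ℚ._+ s) (ℚ.*-zeroʳ c)) (ℚ.+-identityˡ s)

boundary-∉ : ∀ p (π : Vec (Point ℓ) m) c {a} → affine a ∉ vertices p π → boundary p π c a ≡ 0ℚ
boundary-∉ p []      c a∉ = avoiding (c zero) (δ̄-≢ (a∉ ∘ here)) (δ̄-≢ (a∉ ∘ there ∘ here))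
boundary-∉ p (q ∷ π) c a∉ = ≡.trans
  (avoiding (c zero) (δ̄-≢ (a∉ ∘ here)) (δ̄-≢ (a∉ ∘ there ∘ here)))
  (boundary-∉ q π (c ∘ suc) (a∉ ∘ there))

boundary-0 : ∀ p (π : Vec (Point ℓ) m) c a → (∀ g → c g ≡ 0ℚ) → boundary p π c a ≡ 0ℚ
boundary-0 p []      c a c≡0 = passing (c≡0 zero)
boundary-0 p (q ∷ π) c a c≡0 = ≡.trans (passing (c≡0 zero)) (boundary-0 q π (c ∘ suc) a (c≡0 ∘ suc))

private
  ∉-tail : ∀ {p : Point ℓ} {ps} → All (p ≢_) ps → p ∉ ps
  ∉-tail p≢ p∈ = All.lookup p≢ p∈ ≡.refl

  affine≟ : ∀ (a : AffinePoint ℓ) p → Dec (affine a ≡ p)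
  affine≟ a ∞          = no λ ()
  affine≟ a (affine b) = map′ (≡.cong affine) (λ { ≡.refl → ≡.refl }) (a ≟ᵃ b)

-- Coefficients vanish from the end 0 backwards: once the later edges are gone, a vertex sees only
-- its incoming edge. The start `p` is exempt from the hypothesis because in the recursion an edge
-- not yet known to vanish enters it.
boundary-injective-after∞ : ∀ p (π : Vec (Point ℓ) m) c → Unique (vertices p π) →
  ∞ ∉ toList π ++ affine 𝟎 ∷ [] → (∀ a → affine a ≢ p → boundary p π c a ≡ 0ℚ) → ∀ g → c g ≡ 0ℚ
boundary-injective-after∞ p [] c ((p≢𝟎 ∷ _) ∷ _) ∞∉ b≡0 zero =
  incoming (c zero) (δ̄-≢ (p≢𝟎 ∘ ≡.sym)) ≡.refl ≡.refl (b≡0 𝟎 (p≢𝟎 ∘ ≡.sym))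
boundary-injective-after∞ p (∞ ∷ π) c u ∞∉ b≡0 g = contradiction (here ≡.refl) ∞∉
boundary-injective-after∞ p (q@(affine b) ∷ π) c (p∉@(p≢q ∷ _) ∷ u) ∞∉ b≡0 = λ
  { zero    → incoming (c zero) (δ̄-≢ (p≢q ∘ ≡.sym)) (δ̄-≡ b) (boundary-0 q π (c ∘ suc) b c≡0)
                (b≡0 b (p≢q ∘ ≡.sym))
  ; (suc g) → c≡0 g }
  where
  rest : ∀ a → affine a ≢ q → boundary q π (c ∘ suc) a ≡ 0ℚ
  rest a a≢q with affine≟ a p
  -- Nothing is known about the whole boundary at `p`, but the remaining path does not return there.
  ... | yes ≡.refl = boundary-∉ q π (c ∘ suc) (∉-tail p∉)
  ... | no a≢p     = ≡.trans (≡.sym (avoiding (c zero) (δ̄-≢ a≢p) (δ̄-≢ a≢q))) (b≡0 a a≢p)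
  c≡0 : ∀ g → c (suc g) ≡ 0ℚ
  c≡0 = boundary-injective-after∞ q π (c ∘ suc) u (∞∉ ∘ there) rest

-- Until `∞` is reached, the current vertex has no edge left but the outgoing one, so coefficients
-- vanish from the start onwards. Past `∞` the argument runs back from the other end.
boundary-injective : ∀ b (π : Vec (Point ℓ) m) c → Unique (vertices (affine b) π) →
                     (∀ a → boundary (affine b) π c a ≡ 0ℚ) → ∀ g → c g ≡ 0ℚ
boundary-injective b [] c ((b≢𝟎 ∷ _) ∷ _) b≡0 zero =
  outgoing (c zero) (δ̄-≡ b) (δ̄-≢ b≢𝟎) ≡.refl (b≡0 b)
boundary-injective b (q ∷ π) c (b∉@(b≢q ∷ _) ∷ u) b≡0 = λ { zero → c₀≡0 ; (suc g) → c≡0 q u rest g }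
  where
  c₀≡0 : c zero ≡ 0ℚ
  c₀≡0 = outgoing (c zero) (δ̄-≡ b) (δ̄-≢ b≢q) (boundary-∉ q π (c ∘ suc) (∉-tail b∉)) (b≡0 b)
  rest : ∀ a → boundary q π (c ∘ suc) a ≡ 0ℚ
  rest a = ≡.trans (≡.sym (passing c₀≡0)) (b≡0 a)
  c≡0 : ∀ q → Unique (vertices q π) → (∀ a → boundary q π (c ∘ suc) a ≡ 0ℚ) → ∀ g → c (suc g) ≡ 0ℚ
  c≡0 (affine a) u r = boundary-injective a π (c ∘ suc) u r
  c≡0 ∞ u@(∞∉ ∷ _) r = boundary-injective-after∞ ∞ π (c ∘ suc) u (∉-tail ∞∉) (λ a _ → r a)

-- Cell-functions of 01 orderings compared with path products

chain : List (AffinePoint ℓ) → 𝒪 ℓ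
chain []           = con 1ℚ
chain (_ ∷ [])     = con 1ℚ
chain (a ∷ b ∷ as) = 1/ b a * chain (b ∷ as)

-- `chain` does away with the uniqueness proof on which `cellFunction` recurses, so that lists can
-- be cut and joined freely.
cellFunction≡chain : ∀ (ys : List (AffinePoint ℓ)) u → cellFunction ys u ≡ chain ys
cellFunction≡chain []           _               = ≡.refl
cellFunction≡chain (_ ∷ [])     _               = ≡.refl
cellFunction≡chain (a ∷ b ∷ ys) ((a≢b ∷ _) ∷ u) =
  ≡.cong₂ _*_ (≡.sym (1/-≢ (a≢b ∘ ≡.sym))) (cellFunction≡chain (b ∷ ys) u)

module _ {ℓ : ℕ} where
  open 𝒪-Ring {ℓ}
  open ≈-Reasoning

  chain-++ : ∀ as b c cs → chain (as ++ b ∷ c ∷ cs) ≈ chain (as ++ b ∷ []) * (1/ {ℓ} c b * chain (c ∷ cs))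
  chain-++ []            b c cs = sym (*-identityˡ _)
  chain-++ (a ∷ [])      b c cs = sym (*-congʳ (*-identityʳ _))
  chain-++ (a ∷ a′ ∷ as) b c cs = trans (*-congˡ (chain-++ (a′ ∷ as) b c cs)) (sym (*-assoc _ _ _))

  path-affine : ∀ a (π : Vec (Point ℓ) m) → ∞ ∉ toList π →
                path (affine a) π ≈ chain (a ∷ affines (toList π) ++ 𝟎 ∷ [])
  path-affine a []             _  = sym (*-identityʳ _)
  path-affine a (affine b ∷ π) ∞∉ = *-congˡ (path-affine b π (∞∉ ∘ there))
  path-affine a (∞ ∷ π)        ∞∉ = contradiction (here ≡.refl) ∞∉

  path-∞ : ∀ (π : Vec (Point ℓ) m) → ∞ ∉ toList π → path ∞ π ≈ chain (affines (toList π) ++ 𝟎 ∷ [])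
  path-∞ []             _  = refl
  path-∞ (affine b ∷ π) ∞∉ = trans (*-identityˡ _) (path-affine b π (∞∉ ∘ there))
  path-∞ (∞ ∷ π)        ∞∉ = contradiction (here ≡.refl) ∞∉

  path-split : ∀ a (π : Vec (Point ℓ) m) → ∞ ∈ toList π → Unique (toList π) →
               path (affine a) π ≈ chain (a ∷ before∞ (toList π)) * chain (after∞ (toList π) ++ 𝟎 ∷ [])
  path-split a (affine b ∷ π) (there ∞∈) (_ ∷ u) =
    trans (*-congˡ (path-split b π ∞∈ u)) (sym (*-assoc _ _ _))
  path-split a (∞ ∷ π) _ (∞≢ ∷ _) = *-congˡ (path-∞ π λ ∞∈ → All.lookup ∞≢ ∞∈ ≡.refl)

  -- With `π = B, ∞, A` the rotation reads `A, 0, 1, B` and the path reads `1, B, ∞, A, 0`. Edges at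
  -- `∞` count as 1, so the products differ only by the factor `1/(1 - 0) = 1`.
  chain-cut∞ : ∀ (π : Vec (Point ℓ) m) → ∞ ∈ toList π → Unique (toList π) →
               chain (cut∞ (affine 𝟎 ∷ affine 𝟏 ∷ toList π)) ≈ path (affine 𝟏) π
  chain-cut∞ π ∞∈ u = begin
    chain (A ++ 𝟎 ∷ 𝟏 ∷ B)
      ≈⟨ chain-++ A 𝟎 𝟏 B ⟩
    chain (A ++ 𝟎 ∷ []) * (1/[ 𝟏 - 𝟎 ] (λ ()) * chain (𝟏 ∷ B))
      ≈⟨ *-congˡ (trans (*-congʳ (1/[1-0] (λ ()))) (*-identityˡ _)) ⟩
    chain (A ++ 𝟎 ∷ []) * chain (𝟏 ∷ B)
      ≈⟨ *-comm _ _ ⟩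
    chain (𝟏 ∷ B) * chain (A ++ 𝟎 ∷ [])
      ≈⟨ path-split 𝟏 π ∞∈ u ⟨
    path (affine 𝟏) π ∎
    where
    A = after∞ (toList π)
    B = before∞ (toList π)

-- Enumeration of the orderings

ts-suc : ∀ ℓ → ts (suc ℓ) ≡ affine x ∷ map liftᵖ (ts ℓ)
ts-suc ℓ = ≡.cong (affine x ∷_) (≡.trans (List.map-tabulate suc (affine ∘ t))
  (≡.sym (≡.trans (≡.cong (map liftᵖ) (List.map-tabulate id (affine ∘ t)))
                  (List.map-tabulate (affine ∘ t) liftᵖ))))

ts∞-suc : ∀ ℓ → ts (suc ℓ) ++ ∞ ∷ [] ≡ affine x ∷ map liftᵖ (ts ℓ ++ ∞ ∷ [])
ts∞-suc ℓ = ≡.trans (≡.cong (_++ ∞ ∷ []) (ts-suc ℓ))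
  (≡.cong (affine x ∷_) (≡.sym (List.map-++ liftᵖ (ts ℓ) (∞ ∷ []))))

-- A number below `(ℓ + 2)! = (ℓ + 2) · (ℓ + 1)!` encodes a gap for `x` and an ordering of the other
-- points, so the enumeration runs in step with the induction on `ℓ`.
perm : ∀ ℓ → Fin (suc ℓ !) → Vec (Point ℓ) (suc ℓ)
insertion : ∀ ℓ → Fin (suc (suc ℓ)) × Fin (suc ℓ !) → Vec (Point (suc ℓ)) (suc (suc ℓ))
perm zero    _ = ∞ ∷ []
perm (suc ℓ) k = insertion ℓ (remQuot (suc ℓ !) k)
insertion ℓ (g , i) = insertAt (Vec.map liftᵖ (perm ℓ i)) g (affine x)

perm-combine : ∀ ℓ g i → perm (suc ℓ) (combine g i) ≡ insertion ℓ (g , i)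
perm-combine ℓ g i = ≡.cong (insertion ℓ) (Fin.remQuot-combine g i)

insertAt-↭ : ∀ {A : Set} (xs : Vec A m) g y → toList (insertAt xs g y) ↭ y ∷ toList xs
insertAt-↭ xs       zero    y = ↭-refl
insertAt-↭ (z ∷ xs) (suc g) y = ↭-trans (prep z (insertAt-↭ xs g y)) (swap z y ↭-refl)

insertion-↭ : ∀ ℓ gi → toList (insertion ℓ gi) ↭ affine x ∷ map liftᵖ (toList (perm ℓ (proj₂ gi)))
insertion-↭ ℓ (g , i) = ↭-trans (insertAt-↭ _ g (affine x))
  (↭-reflexive (≡.cong (affine x ∷_) (Vec.toList-map liftᵖ (perm ℓ i))))

perm-↭ : ∀ ℓ k → toList (perm ℓ k) ↭ ts ℓ ++ ∞ ∷ []
perm-↭ zero    k = ↭-refl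
perm-↭ (suc ℓ) k = ↭-trans (insertion-↭ ℓ (remQuot (suc ℓ !) k))
  (↭-trans (prep (affine x) (map⁺ liftᵖ (perm-↭ ℓ (proj₂ (remQuot {suc (suc ℓ)} (suc ℓ !) k)))))
           (↭-reflexive (≡.sym (ts∞-suc ℓ))))

vertices-insertion : ∀ ℓ gi → vertices (affine 𝟏) (insertion ℓ gi) ↭
                              affine x ∷ map liftᵖ (vertices (affine 𝟏) (perm ℓ (proj₂ gi)))
vertices-insertion ℓ gi@(g , i) =
  ↭-trans (prep (affine 𝟏) (++⁺ʳ (affine 𝟎 ∷ []) (insertion-↭ ℓ gi)))
  (↭-trans (swap (affine 𝟏) (affine x) ↭-refl)
  (↭-reflexive (≡.cong (λ xs → affine x ∷ affine 𝟏 ∷ xs)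
    (≡.sym (List.map-++ liftᵖ (toList (perm ℓ i)) (affine 𝟎 ∷ []))))))

affine-injective : ∀ {a b : AffinePoint ℓ} → affine a ≡ affine b → a ≡ b
affine-injective ≡.refl = ≡.refl

liftᵖ-injective : ∀ {p q : Point ℓ} → liftᵖ p ≡ liftᵖ q → p ≡ q
liftᵖ-injective {p = ∞}        {∞}        _  = ≡.refl
liftᵖ-injective {p = affine a} {affine b} eq = ≡.cong affine (liftᵃ-injective (affine-injective eq))

liftᵖ≢x : ∀ {p : Point ℓ} → affine x ≢ liftᵖ p
liftᵖ≢x {p = affine a} eq = liftᵃ≢x (affine-injective eq)

vertices-unique : ∀ ℓ k → Unique (vertices (affine 𝟏) (perm ℓ k))
vertices-unique zero    _ = ((λ ()) ∷ (λ ()) ∷ []) ∷ ((λ ()) ∷ []) ∷ [] ∷ []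
vertices-unique (suc ℓ) k =
  PermutationSetoid.Unique-resp-↭ (≡.setoid _) (↭⇒↭ₛ (↭-sym (vertices-insertion ℓ (remQuot (suc ℓ !) k))))
    (All.tabulate (λ p∈ eq → x∉ (≡.subst (_∈ _) (≡.sym eq) p∈)) ∷ Unique.map⁺ liftᵖ-injective (vertices-unique ℓ _))
  where
  x∉ : ∀ {ps} → affine x ∉ map liftᵖ ps
  x∉ x∈ with ∈-map⁻ liftᵖ x∈
  ... | _ , _ , eq = liftᵖ≢x eq

∈-vertices : ∀ ℓ k p → p ∈ vertices (affine 𝟏) (perm ℓ k)
∈-vertices zero    _ (affine 𝟎) = there (there (here ≡.refl))
∈-vertices zero    _ (affine 𝟏) = here ≡.refl
∈-vertices zero    _ ∞          = there (here ≡.refl)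
∈-vertices (suc ℓ) k p = ∈-resp-↭ (↭-sym (vertices-insertion ℓ (remQuot (suc ℓ !) k))) (go p)
  where
  go : ∀ p → p ∈ affine x ∷ map liftᵖ (vertices (affine 𝟏) (perm ℓ _))
  go ∞ = there (∈-map⁺ liftᵖ (∈-vertices ℓ _ ∞))
  go (affine a) with lifted a
  ... | new   = here ≡.refl
  ... | old b = there (∈-map⁺ liftᵖ (∈-vertices ℓ _ (affine b)))

insertAt-surjective : ∀ {A : Set} (v : Vec A m) ys zs y → toList v ≡ ys ++ zs →
                      ∃ λ g → toList (insertAt v g y) ≡ ys ++ y ∷ zs
insertAt-surjective v       []       zs y eq = zero , ≡.cong (y ∷_) eq
insertAt-surjective (z ∷ v) (_ ∷ ys) zs y eq =
  let z≡ , eq′ = List.∷-injective eq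
      g , r    = insertAt-surjective v ys zs y eq′
  in suc g , ≡.cong₂ _∷_ z≡ r

-- Taking `x` out of `xs` leaves a permutation of lifted points, which is the lift of an ordering
-- reached by induction; `x` then returns to its gap.
perm-surjective : ∀ ℓ xs → xs ↭ ts ℓ ++ ∞ ∷ [] → ∃ λ k → toList (perm ℓ k) ≡ xs
perm-surjective zero    xs p = zero , ≡.sym (↭-singleton-inv p)
perm-surjective (suc ℓ) xs p
  with p′ ← ↭-trans p (↭-reflexive (ts∞-suc ℓ))
  with ys , zs , ≡.refl ← ∈-∃++ (∈-resp-↭ (↭-sym p′) (here ≡.refl))
  with w , ys++zs≡ , w↭ ← ↭-map-inv liftᵖ (↭-sym (drop-mid ys [] p′))
  with i , eq ← perm-surjective ℓ w (↭-sym w↭)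
  with g , r ← insertAt-surjective (Vec.map liftᵖ (perm ℓ i)) ys zs (affine x)
                 (≡.trans (Vec.toList-map liftᵖ (perm ℓ i)) (≡.trans (≡.cong (map liftᵖ) eq) (≡.sym ys++zs≡)))
  = combine g i , ≡.trans (≡.cong toList (perm-combine ℓ g i)) r

unique-++⁻ˡ : ∀ {A : Set} (ys : List A) {zs} → Unique (ys ++ zs) → Unique ys
unique-++⁻ˡ []       _        = []
unique-++⁻ˡ (_ ∷ ys) (y∉ ∷ u) = All.++⁻ˡ ys y∉ ∷ unique-++⁻ˡ ys u

ordering : ∀ ℓ → Fin (suc ℓ !) → Ordering₀₁ ℓ
ordering ℓ k = toList (perm ℓ k) , perm-↭ ℓ k

-- The function f for which f dt₁ ⋯ dt_ℓ is the k-th 01 cell-form.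
cell : ∀ ℓ → Fin (suc ℓ !) → 𝒪 ℓ
cell ℓ k = path (affine 𝟏) (perm ℓ k)

cellForm≡chain : ∀ (γ : CyclicOrdering ℓ) I → cellForm γ I ≡ chain (cut∞ (proj₁ γ))
cellForm≡chain γ I = cellFunction≡chain (cut∞ (proj₁ γ)) (cut∞-unique γ)

-- The same list may carry different permutation proofs, which enter `cellForm` through
-- `cut∞-unique`; `chain` sees the list alone.
cellForm₀₁-cong : ∀ (π ρ : Ordering₀₁ ℓ) → proj₁ π ≡ proj₁ ρ → ∀ I → cellForm₀₁ π I ≡ cellForm₀₁ ρ I
cellForm₀₁-cong π ρ eq I = ≡.trans (cellForm≡chain ⟨0,1, π ⟩ I)
  (≡.trans (≡.cong (λ xs → chain (cut∞ (affine 𝟎 ∷ affine 𝟏 ∷ xs))) eq) (≡.sym (cellForm≡chain ⟨0,1, ρ ⟩ I)))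

cellForm₀₁-cell : ∀ ℓ k I → cellForm₀₁ (ordering ℓ k) I ≈ cell ℓ k
cellForm₀₁-cell ℓ k I = ≡.subst (_≈ cell ℓ k)
  (≡.sym (cellForm≡chain ⟨0,1, ordering ℓ k ⟩ I))
  (chain-cut∞ (perm ℓ k) (∈-resp-↭ (↭-sym (perm-↭ ℓ k)) (∈-++⁺ʳ (ts ℓ) (here ≡.refl))) perm-unique)
  where
  perm-unique : Unique (toList (perm ℓ k))
  perm-unique with _ ∷ u ← vertices-unique ℓ k = unique-++⁻ˡ (toList (perm ℓ k)) u

-- The basis

combination : Vector ℚ n → Vector (𝒪 ℓ) n → 𝒪 ℓ
combination c v = 𝒪-Ring.sum λ i → con (c i) * v i

indicator : Fin n → Vector ℚ n
indicator i j = if does (j Fin.≟ i) then 1ℚ else 0ℚ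

indicator-≡ : ∀ (i : Fin n) → indicator i i ≡ 1ℚ
indicator-≡ i with i Fin.≟ i
... | yes _  = ≡.refl
... | no i≢i = ⊥-elim (i≢i ≡.refl)

indicator-≢ : ∀ {i j : Fin n} → j ≢ i → indicator i j ≡ 0ℚ
indicator-≢ {i = i} {j} j≢i with j Fin.≟ i
... | yes j≡i = ⊥-elim (j≢i j≡i)
... | no _    = ≡.refl

module _ {ℓ : ℕ} where
  open 𝒪-Ring {ℓ}
  open ≈-Reasoning

  combination-+ : ∀ (c c′ : Vector ℚ n) (v : Vector (𝒪 ℓ) n) →
                  combination (λ i → c i ℚ.+ c′ i) v ≈ combination c v + combination c′ v
  combination-+ c c′ v = trans
    (sum-cong-≋ λ i → trans (*-congʳ (con-+ (c i) (c′ i))) (distribʳ (v i) (con (c i)) (con (c′ i))))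
    (∑-distrib-+ (λ i → con (c i) * v i) (λ i → con (c′ i) * v i))

  combination-* : ∀ q (c : Vector ℚ n) (v : Vector (𝒪 ℓ) n) →
                  combination (λ i → q ℚ.* c i) v ≈ con q * combination c v
  combination-* q c v = trans
    (sum-cong-≋ λ i → trans (*-congʳ (con-* q (c i))) (*-assoc (con q) (con (c i)) (v i)))
    (sym (*-distribˡ-sum (con q) (λ i → con (c i) * v i)))

  combination-0 : ∀ (v : Vector (𝒪 ℓ) n) → combination (λ _ → 0ℚ) v ≈ con 0ℚ
  combination-0 v = sum-0 _ λ i → zeroˡ (v i)

  combination-indicator : ∀ i (v : Vector (𝒪 ℓ) n) → combination (indicator i) v ≈ v i
  combination-indicator i v = trans
    (sum-single (λ j → con (indicator i j) * v j) i λ j j≢i →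
      trans (*-congʳ (reflexive (≡.cong con (indicator-≢ j≢i)))) (zeroˡ (v j)))
    (trans (*-congʳ (reflexive (≡.cong con (indicator-≡ i)))) (*-identityˡ (v i)))

  Spanned : Vector (𝒪 ℓ) n → 𝒪 ℓ → Set
  Spanned v f = ∃ λ c → Null (f + - combination c v)

  module _ {v : Vector (𝒪 ℓ) n} where
    spanned-resp : ∀ {f g} → f ≈ g → Spanned v f → Spanned v g
    spanned-resp p (c , m) = c , resp (+-cong p refl) m

    spanned-+ : ∀ {f g} → Spanned v f → Spanned v g → Spanned v (f + g)
    spanned-+ {f} {g} (c , m) (c′ , m′) = (λ i → c i ℚ.+ c′ i) , resp (begin
      (f + - combination c v) + (g + - combination c′ v)
        ≈⟨ solve 4 (λ f g x y → ((f :+ :- x) :+ (g :+ :- y)) := ((f :+ g) :+ :- (x :+ y))) refl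
             f g (combination c v) (combination c′ v) ⟩
      f + g + - (combination c v + combination c′ v)
        ≈⟨ +-congˡ (-‿cong (combination-+ c c′ v)) ⟨
      f + g + - combination (λ i → c i ℚ.+ c′ i) v ∎) (+-null m m′)

    spanned-* : ∀ q {f} → Spanned v f → Spanned v (con q * f)
    spanned-* q {f} (c , m) = (λ i → q ℚ.* c i) , resp (begin
      con q * (f + - combination c v)
        ≈⟨ solve 3 (λ q f x → (q :* (f :+ :- x)) := (q :* f :+ :- (q :* x))) refl (con q) f (combination c v) ⟩
      con q * f + - (con q * combination c v)
        ≈⟨ +-congˡ (-‿cong (combination-* q c v)) ⟨
      con q * f + - combination (λ i → q ℚ.* c i) v ∎) (con*-null q m)

    spanned-‿- : ∀ {f} → Spanned v f → Spanned v (- f)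
    spanned-‿- s = spanned-resp (trans (*-congʳ (con-‿- 1ℚ)) (-1*x≈-x _)) (spanned-* (ℚ.- 1ℚ) s)

    null-spanned : ∀ {f} → Null f → Spanned v f
    null-spanned {f} m = (λ _ → 0ℚ) , resp (begin
      f                                ≈⟨ +-identityʳ f ⟨
      f + con 0ℚ                       ≈⟨ +-congˡ -0#≈0# ⟨
      f + - con 0ℚ                     ≈⟨ +-congˡ (-‿cong (combination-0 v)) ⟨
      f + - combination (λ _ → 0ℚ) v   ∎) m

    member-spanned : ∀ i → Spanned v (v i)
    member-spanned i = indicator i , resp
      (sym (trans (+-congˡ (-‿cong (combination-indicator i v))) (-‿inverseʳ (v i)))) 0-null

-- 𝔐₀,₃ is a point.
evaluate : 𝒪 0 → ℚ
evaluate (con q) = q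
evaluate (f + g) = evaluate f ℚ.+ evaluate g
evaluate (f * g) = evaluate f ℚ.* evaluate g
evaluate (- f)   = ℚ.- evaluate f
evaluate (1/[ 𝟏 - 𝟎 ] _) = 1ℚ
evaluate (1/[ 𝟎 - 𝟏 ] _) = ℚ.- 1ℚ
evaluate (1/[ 𝟎 - 𝟎 ] 0≢0) = ⊥-elim-irr (0≢0 ≡.refl)
evaluate (1/[ 𝟏 - 𝟏 ] 1≢1) = ⊥-elim-irr (1≢1 ≡.refl)

evaluate-cong : ∀ {f g} → f ≈ g → evaluate f ≡ evaluate g
evaluate-cong refl              = ≡.refl
evaluate-cong (sym p)           = ≡.sym (evaluate-cong p)
evaluate-cong (trans p q)       = ≡.trans (evaluate-cong p) (evaluate-cong q)
evaluate-cong (+-cong p q)      = ≡.cong₂ ℚ._+_ (evaluate-cong p) (evaluate-cong q)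
evaluate-cong (*-cong p q)      = ≡.cong₂ ℚ._*_ (evaluate-cong p) (evaluate-cong q)
evaluate-cong (-‿cong p)        = ≡.cong ℚ.-_ (evaluate-cong p)
evaluate-cong (+-assoc f g h)   = ℚ.+-assoc (evaluate f) (evaluate g) (evaluate h)
evaluate-cong (+-comm f g)      = ℚ.+-comm (evaluate f) (evaluate g)
evaluate-cong (+-identityˡ f)   = ℚ.+-identityˡ (evaluate f)
evaluate-cong (-‿inverseˡ f)    = ℚ.+-inverseˡ (evaluate f)
evaluate-cong (*-assoc f g h)   = ℚ.*-assoc (evaluate f) (evaluate g) (evaluate h)
evaluate-cong (*-comm f g)      = ℚ.*-comm (evaluate f) (evaluate g)
evaluate-cong (*-identityˡ f)   = ℚ.*-identityˡ (evaluate f)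
evaluate-cong (distribˡ f g h)  = ℚ.*-distribˡ-+ (evaluate f) (evaluate g) (evaluate h)
evaluate-cong (con-+ _ _)       = ≡.refl
evaluate-cong (con-* _ _)       = ≡.refl
evaluate-cong (1/-inverseˡ 𝟏 𝟎 _) = ≡.refl
evaluate-cong (1/-inverseˡ 𝟎 𝟏 _) = ≡.refl
evaluate-cong (1/-inverseˡ 𝟎 𝟎 0≢0) = ⊥-elim-irr (0≢0 ≡.refl)
evaluate-cong (1/-inverseˡ 𝟏 𝟏 1≢1) = ⊥-elim-irr (1≢1 ≡.refl)

con-evaluate : ∀ f → f ≈ con (evaluate f)
con-evaluate (con q) = refl
con-evaluate (f + g) = trans (+-cong (con-evaluate f) (con-evaluate g)) (sym (con-+ _ _))
con-evaluate (f * g) = trans (*-cong (con-evaluate f) (con-evaluate g)) (sym (con-* _ _))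
con-evaluate (- f)   = trans (-‿cong (con-evaluate f)) (sym (𝒪-Ring.con-‿- _))
con-evaluate (1/[ 𝟏 - 𝟎 ] 1≢0) = 1/[1-0] 1≢0
con-evaluate (1/[ 𝟎 - 𝟏 ] 0≢1) =
  trans (1/-swap 𝟎 𝟏 0≢1) (trans (-‿cong (1/[1-0] _)) (sym (𝒪-Ring.con-‿- 1ℚ)))
con-evaluate (1/[ 𝟎 - 𝟎 ] 0≢0) = ⊥-elim-irr (0≢0 ≡.refl)
con-evaluate (1/[ 𝟏 - 𝟏 ] 1≢1) = ⊥-elim-irr (1≢1 ≡.refl)

-- For `ℓ = 0` there is no coordinate, so `∂-null` cannot occur.
null-evaluate : ∀ {f} → Null f → evaluate f ≡ 0ℚ
null-evaluate 0-null       = ≡.refl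
null-evaluate (+-null m n) = ≡.cong₂ ℚ._+_ (null-evaluate m) (null-evaluate n)
null-evaluate (resp p n)   = ≡.trans (≡.sym (evaluate-cong p)) (null-evaluate n)

-- Spanning

cell-spanned : ∀ ℓ f → Spanned (cell ℓ) f
cell-spanned zero f = spanned-resp {v = cell 0} (begin
  -- The product of ones is the only cell-function here, that of the path `1, ∞, 0`.
  con (evaluate f) * (con 1ℚ * con 1ℚ)  ≈⟨ *-congˡ (*-identityˡ _) ⟩
  con (evaluate f) * con 1ℚ             ≈⟨ *-identityʳ _ ⟩
  con (evaluate f)                      ≈⟨ con-evaluate f ⟨
  f                                     ∎) (spanned-* {v = cell 0} (evaluate f) (member-spanned {v = cell 0} zero))
  where
  open 𝒪-Ring
  open ≈-Reasoning
cell-spanned (suc ℓ) = simple-poles P spanned-resp spanned-+ null-spanned simple-pole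
  where
  open 𝒪-Ring {suc ℓ}
  P : 𝒪 (suc ℓ) → Set
  P = Spanned (cell (suc ℓ))

  -- By `path-insert`, the difference along edge `g` times the pulled-back cell-function is the
  -- cell-function with `x` inserted at `g`.
  cell-pole : ∀ i a → P (ι (cell ℓ i) * e a)
  cell-pole i a = telescope P spanned-resp spanned-+ spanned-‿- (null-spanned 0-null) (ι (cell ℓ i))
    (affine 𝟏) (perm ℓ i) (∈-vertices ℓ i ∞)
    (λ g → spanned-resp (trans (reflexive (≡.cong (path (affine 𝟏)) (perm-combine ℓ g i)))
                               (path-insert (affine 𝟏) (perm ℓ i) (vertices-unique ℓ i) g))
                        (member-spanned (combine g i)))
    (∈-vertices ℓ i (affine a))

  sum-pole : ∀ a {n} (f : Vector (𝒪 ℓ) n) → (∀ i → P (ι (f i) * e a)) → P (ι (𝒪-Ring.sum f) * e a)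
  sum-pole a {zero}  f p = null-spanned (ι*e-null a 0-null)
  sum-pole a {suc n} f p = spanned-resp (sym (distribʳ _ _ _)) (spanned-+ (p zero) (sum-pole a (f ∘ suc) (p ∘ suc)))

  -- The residue `f` is a combination of cell-functions plus a null function, and the null part
  -- stays null at the pole by `ι*e-null`.
  simple-pole : ∀ f a → P (ι f * e a)
  simple-pole f a with c , n ← cell-spanned ℓ f = spanned-resp
    (solve 3 (λ f s e → ((f :+ :- s) :* e :+ s :* e) := (f :* e)) refl (ι f) (ι (combination c (cell ℓ))) (e a))
    (spanned-+ (null-spanned (ι*e-null a n))
      (sum-pole a (λ i → con (c i) * cell ℓ i) λ i →
        spanned-resp (sym (*-assoc (con (c i)) (ι (cell ℓ i)) (e a))) (spanned-* (c i) (cell-pole i a))))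

-- Linear independence by residues

module _ {ℓ : ℕ} where
  open 𝒪-Ring {ℓ}
  open ≈-Reasoning
  open SemiringSum semiring using (∑-comm)

  sum-+ : ∀ m {n} (f : Vector (𝒪 ℓ) (m ℕ.+ n)) → sum f ≈ sum (λ i → f (i ↑ˡ n)) + sum (λ j → f (m ↑ʳ j))
  sum-+ zero    f = sym (+-identityˡ _)
  sum-+ (suc m) f = trans (+-congˡ (sum-+ m (f ∘ suc))) (sym (+-assoc _ _ _))

  sum-combine : ∀ m {n} (f : Vector (𝒪 ℓ) (m ℕ.* n)) → sum f ≈ sum λ i → sum λ j → f (combine {m} i j)
  sum-combine zero        f = refl
  sum-combine (suc m) {n} f = trans (sum-+ n f) (+-congˡ (sum-combine m (λ j → f (n ↑ʳ j))))

  con-sum : ∀ (c : Vector ℚ n) → con (ℚΣ.sum c) ≈ sum (con ∘ c)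
  con-sum {zero}  c = refl
  con-sum {suc n} c = trans (con-+ _ _) (+-congˡ (con-sum (c ∘ suc)))

  -- Since `w (combine g i)` is a multiple of a vector depending on `i` alone, the terms can be
  -- collected by `i`.
  combination-combine : ∀ m {n} (c : Vector ℚ (m ℕ.* n)) (w : Vector (𝒪 ℓ) (m ℕ.* n))
    (b : Fin m → Fin n → ℚ) (v : Vector (𝒪 ℓ) n) →
    (∀ g i → w (combine g i) ≈ con (b g i) * v i) →
    combination c w ≈ combination (λ i → ℚΣ.sum λ g → c (combine g i) ℚ.* b g i) v
  combination-combine m {n} c w b v w≈ = begin
    combination c w
      ≈⟨ sum-combine m (λ k → con (c k) * w k) ⟩
    sum {m} (λ g → sum {n} (λ i → con (c (combine g i)) * w (combine g i)))
      ≈⟨ ∑-comm {m} {n} (λ g i → con (c (combine g i)) * w (combine g i)) ⟩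
    sum {n} (λ i → sum {m} (λ g → con (c (combine g i)) * w (combine g i)))
      ≈⟨ sum-cong-≋ {n} (λ i → sum-cong-≋ {m} (λ g → trans (*-congˡ (w≈ g i))
           (trans (sym (*-assoc (con (c (combine g i))) (con (b g i)) (v i)))
                  (*-congʳ (sym (con-* (c (combine g i)) (b g i))))))) ⟩
    sum {n} (λ i → sum {m} (λ g → con (c (combine g i) ℚ.* b g i) * v i))
      ≈⟨ sum-cong-≋ {n} (λ i → *-distribʳ-sum (v i) (λ g → con (c (combine g i) ℚ.* b g i))) ⟨
    sum {n} (λ i → sum {m} (λ g → con (c (combine g i) ℚ.* b g i)) * v i)
      ≈⟨ sum-cong-≋ {n} (λ i → *-congʳ (con-sum {m} (λ g → c (combine g i) ℚ.* b g i))) ⟨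
    combination (λ i → ℚΣ.sum {m} λ g → c (combine g i) ℚ.* b g i) v ∎
    where open SemiringSum semiring using (*-distribʳ-sum)

  module _ (a : AffinePoint ℓ) where
    private R = residue a

    residue-null : ∀ {f} → Null f → Null (R f)
    residue-null (∂-null zero f)    = resp (sym (residue-∂x a f)) 0-null
    residue-null (∂-null (suc i) f) = resp (sym (residue-∂ a i f)) (∂-null i (R f))
    residue-null 0-null             = resp (sym (zeroʳ _)) 0-null
    residue-null (+-null m n)       = +-null (residue-null m) (residue-null n)
    residue-null (resp p n)         = resp (residue-cong a p) (residue-null n)

    residue-sum : ∀ (f : Vector (𝒪 (suc ℓ)) n) → R (𝒪-Ring.sum f) ≈ sum (R ∘ f)
    residue-sum {zero}  f = zeroʳ _
    residue-sum {suc n} f = +-congˡ (residue-sum (f ∘ suc))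

    residue-ē : ∀ f p → R (ι f * ē p) ≈ con (δ̄ a p) * f
    residue-ē f (affine b) = residue-pole a f b
    residue-ē f ∞ = trans (residue-cong a {ι f * con 0ℚ} {con 0ℚ} (𝒪-Ring.zeroʳ _))
                          (trans (zeroʳ _) (sym (zeroˡ f)))

    residue-cell : ∀ g i → R (cell (suc ℓ) (combine g i)) ≈
                   con (δ̄ a (source (affine 𝟏) (perm ℓ i) g) ℚ.- δ̄ a (target (affine 𝟏) (perm ℓ i) g)) * cell ℓ i
    residue-cell g i = begin
      R (cell (suc ℓ) (combine g i))
        ≡⟨ ≡.cong (λ π → R (path (affine 𝟏) π)) (perm-combine ℓ g i) ⟩
      R (path (affine 𝟏) (insertion ℓ (g , i)))
        ≈⟨ residue-cong a (path-insert (affine 𝟏) (perm ℓ i) (vertices-unique ℓ i) g) ⟩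
      R (ι f * (ē p + - ē q))
        ≈⟨ residue-cong a (x[y-z]≈xy-xz (ι f) (ē p) (ē q)) ⟩
      R (ι f * ē p) + - R (ι f * ē q)
        ≈⟨ +-cong (residue-ē f p) (-‿cong (residue-ē f q)) ⟩
      con (δ̄ a p) * f + - (con (δ̄ a q) * f)
        ≈⟨ solve 3 (λ p q f → (p :* f :+ :- (q :* f)) := ((p :+ :- q) :* f)) refl (con (δ̄ a p)) (con (δ̄ a q)) f ⟩
      (con (δ̄ a p) + - con (δ̄ a q)) * f
        ≈⟨ *-congʳ (trans (con-+ _ _) (+-congˡ (con-‿- _))) ⟨
      con (δ̄ a p ℚ.- δ̄ a q) * f ∎
      where
      open RingProperties (𝒪-Ring.ring {suc ℓ}) using (x[y-z]≈xy-xz)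
      f = cell ℓ i
      p = source (affine 𝟏) (perm ℓ i) g
      q = target (affine 𝟏) (perm ℓ i) g

    -- For each ordering `i` the coefficients on its gaps form a 1-chain on its path, and the
    -- residue along `x = a` reads off the boundary of that chain at `a`.
    residue-combination : ∀ (c : Vector ℚ (suc (suc ℓ) !)) → R (combination c (cell (suc ℓ))) ≈
      combination (λ i → boundary (affine 𝟏) (perm ℓ i) (λ g → c (combine g i)) a) (cell ℓ)
    residue-combination c = trans
      (residue-sum (λ k → con (c k) * cell (suc ℓ) k))
      (combination-combine (suc (suc ℓ)) {suc ℓ !} c (λ k → R (cell (suc ℓ) k)) _ (cell ℓ) residue-cell)

-- All residues of a null combination are null, so by induction every chain of coefficients on a
-- path has zero boundary, and `boundary-injective` applies.
cell-independent : ∀ ℓ c → Null (combination c (cell ℓ)) → ∀ k → c k ≡ 0ℚ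
cell-independent zero c n zero = ≡.trans
  (≡.sym (≡.trans (ℚ.+-identityʳ (c zero ℚ.* 1ℚ)) (ℚ.*-identityʳ (c zero)))) (null-evaluate n)
cell-independent (suc ℓ) c n k = ≡.subst (λ k → c k ≡ 0ℚ) (Fin.combine-remQuot (suc ℓ !) k)
  (boundary-injective 𝟏 (perm ℓ i) (λ g → c (combine g i)) (vertices-unique ℓ i)
    (λ a → cell-independent ℓ _ (resp (residue-combination a c) (residue-null a n)) i) g)
  where
  g = proj₁ (remQuot {suc (suc ℓ)} (suc ℓ !) k)
  i = proj₂ (remQuot {suc (suc ℓ)} (suc ℓ !) k)

-- If two different indices had equal cell-functions, coefficients 1 and -1 would give a vanishing
-- combination. Hence the cardinality is a by-product of independence.
cell-injective : ∀ ℓ i j → cell ℓ i ≈ cell ℓ j → i ≡ j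
cell-injective ℓ i j p with i Fin.≟ j
... | yes i≡j = i≡j
... | no i≢j  = ⊥-elim (1≢0 (≡.trans (≡.sym (≡.cong₂ (λ a b → a ℚ.+ (ℚ.- 1ℚ) ℚ.* b) (indicator-≡ i) (indicator-≢ i≢j)))
    (cell-independent ℓ c (resp (sym (begin
      combination c (cell ℓ)
        ≈⟨ combination-+ (indicator i) (λ k → (ℚ.- 1ℚ) ℚ.* indicator j k) (cell ℓ) ⟩
      combination (indicator i) (cell ℓ) + combination (λ k → (ℚ.- 1ℚ) ℚ.* indicator j k) (cell ℓ)
        ≈⟨ +-cong (combination-indicator i (cell ℓ)) (combination-* (ℚ.- 1ℚ) (indicator j) (cell ℓ)) ⟩
      cell ℓ i + con (ℚ.- 1ℚ) * combination (indicator j) (cell ℓ)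
        ≈⟨ +-cong p (trans (*-cong (con-‿- 1ℚ) (combination-indicator j (cell ℓ))) (-1*x≈-x _)) ⟩
      cell ℓ j + - cell ℓ j
        ≈⟨ -‿inverseʳ _ ⟩
      con 0ℚ ∎)) 0-null) i)))
  where
  open 𝒪-Ring {ℓ}
  open ≈-Reasoning
  c : Vector ℚ (suc ℓ !)
  c k = indicator i k ℚ.+ (ℚ.- 1ℚ) ℚ.* indicator j k
  1≢0 : 1ℚ ≢ 0ℚ
  1≢0 ()

-- From functions to cohomology classes

module _ (ℓ : ℕ) where
  private module H = LeftModule (H ℓ ℓ)
  open RawMonoidDefs H.+ᴹ-rawMonoid using () renaming (sum to sumᴴ)
  open 𝒪-Ring {ℓ}

  orderings : Bijection (setoid (Fin (suc ℓ !))) (CellForms₀₁ ℓ)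
  orderings = record
    { to        = ordering ℓ
    ; cong      = λ { ≡.refl _ → refl }
    ; bijective =
        (λ {i} {j} p → cell-injective ℓ i j
          (trans (sym (cellForm₀₁-cell ℓ i (full ℓ))) (trans (p (full ℓ)) (cellForm₀₁-cell ℓ j (full ℓ)))))
      , λ π → let k , eq = perm-surjective ℓ (proj₁ π) (proj₂ π) in
          k , λ { ≡.refl I → reflexive (cellForm₀₁-cong (ordering ℓ k) π eq I) }
    }

  sumᴴ-cellForms : ∀ {n} (c : Vector ℚ n) (ω : Vector (Ω ℓ ℓ) n) (f : Vector (𝒪 ℓ) n) → (∀ k I → ω k I ≈ f k) →
                   ∀ I → proj₁ (sumᴴ λ k → c k H.*ₗ [ ω k ]) I ≈ combination c f
  sumᴴ-cellForms {zero}  c ω f p I = refl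
  sumᴴ-cellForms {suc n} c ω f p I =
    +-cong (*-congˡ (p zero I)) (sumᴴ-cellForms (c ∘ suc) (ω ∘ suc) (f ∘ suc) (p ∘ suc) I)

  private
    Σcellforms : Vector ℚ (suc ℓ !) → Ω ℓ ℓ
    Σcellforms c = proj₁ (sumᴴ λ k → c k H.*ₗ [ cellForm₀₁ (ordering ℓ k) ])

    Σcellforms≈ : ∀ c I → Σcellforms c I ≈ combination c (cell ℓ)
    Σcellforms≈ c = sumᴴ-cellForms c (cellForm₀₁ ∘ ordering ℓ) (cell ℓ) (cellForm₀₁-cell ℓ)

  -- The hypothesis is equality with 0 in `H`, unfolded: the difference with the zero form is exact.
  cellForms-independent : ∀ c → Exact (Σcellforms c +Ω (-Ω 0Ω)) → ∀ k → c k ≡ 0ℚ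
  cellForms-independent c ex = cell-independent ℓ c
    (resp (trans (+-congˡ -0#≈0#) (trans (+-identityʳ _) (Σcellforms≈ c (full ℓ))))
          (exact⇒null (Σcellforms c +Ω (-Ω 0Ω)) ex))

  null⇒exact-remainder : ∀ (ω : Ω ℓ ℓ) c → Null (ω (full ℓ) + - combination c (cell ℓ)) →
                         Exact (ω +Ω (-Ω Σcellforms c))
  null⇒exact-remainder ω c n = exact-cong {ω = λ _ → f} (λ I → remainder≈ I) (null⇒exact n)
    where
    f : 𝒪 ℓ
    f = ω (full ℓ) + - combination c (cell ℓ)
    remainder≈ : ∀ I → f ≈ (ω +Ω (-Ω Σcellforms c)) I
    remainder≈ I = +-cong (≡.subst (λ J → ω (full ℓ) ≈ ω J) (≡.sym (full-unique I)) refl)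
                          (-‿cong (sym (Σcellforms≈ c I)))

  cellForms-spanning : ∀ (ω : Ω ℓ ℓ) → ∃ λ c → Exact (ω +Ω (-Ω Σcellforms c))
  cellForms-spanning ω = proj₁ (cell-spanned ℓ (ω (full ℓ))) ,
    null⇒exact-remainder ω (proj₁ (cell-spanned ℓ (ω (full ℓ)))) (proj₂ (cell-spanned ℓ (ω (full ℓ))))

  cellForms-basis : IsBasis (H ℓ ℓ) (λ k → [ cellForm₀₁ (Bijection.to orderings k) ])
  cellForms-basis = record
    { linearlyIndependent = cellForms-independent
    ; spanning            = λ x → cellForms-spanning (proj₁ x)
    }

-- A record, so that Basis₀₁ (suc (suc (suc ℓ)) ∸ 3) … is recognised as
-- Basis₀₁ ℓ … without comparing the two cohomology modules.
record Basis₀₁ (ℓ N : ℕ) : Set where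
  constructor basis
  field
    enumeration : Bijection (setoid (Fin (N !))) (CellForms₀₁ ℓ)
    isBasis     : IsBasis (H ℓ ℓ) (λ i → [ cellForm₀₁ (Bijection.to enumeration i) ])

orderings-basis : ∀ ℓ → Basis₀₁ ℓ (suc ℓ)
orderings-basis ℓ = basis (orderings ℓ) (cellForms-basis ℓ)

basis₀₁ : ∀ n → 4 ≤ n → Basis₀₁ (n ∸ 3) (n ∸ 2)
basis₀₁ (suc zero)          (s≤s ())
basis₀₁ (suc (suc zero))    (s≤s (s≤s ()))
basis₀₁ (suc (suc (suc ℓ))) _ = orderings-basis ℓ

theorem2p12 : (n : ℕ) → 4 ≤ n → let ℓ = n ∸ 3 in
    Σ[ e ∈ Bijection (setoid (Fin ((n ∸ 2) !))) (CellForms₀₁ ℓ) ]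
    IsBasis (H ℓ ℓ) (λ i → [ cellForm₀₁ (Bijection.to e i) ])
theorem2p12 n 4≤n = Basis₀₁.enumeration b , Basis₀₁.isBasis b
  where b = basis₀₁ n 4≤n
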